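{- Let $p$ be a prime number, $n\geq 1$ an integer and $N=p^{n}$. Let $k\in\mathbb{Z}$, and write $\overline{k}=k+N\mathbb{Z}$. (i) Suppose $p\neq 2$. The $\overline{k}$-monomial minimal solution of $(E_{N})$ is irreducible if and only if $p$ does not divide $k$. In particular, $(E_{N})$ has exactly $\varphi(p^{n})=p^{n-1}(p-1)$ irreducible monomial minimal solutions. (ii) Suppose $p=2$. The $\overline{k}$-monomial minimal solution of $(E_{N})$ is irreducible if and only if at least one of the following properties holds: - $k$ is odd; - $\overline{k}=\overline{2^{n-1}}$; - $n\geq 2$ and there exists an odd integer $a$ such that $k=2a$. In particular, if $n\geq 3$, $(E_{N})$ has exactly $3\times 2^{n-2}+1$ irreducible monomial minimal solutions.
   Context: Let $N\geq 2$ be an integer and write $\overline{a}=a+N\mathbb{Z}$ for $a\in\mathbb{Z}$. For $\overline{a_1},\ldots,\overline{a_s}\in\mathbb{Z}/N\mathbb{Z}$ put $$M_s(\overline{a_1},\ldots,\overline{a_s})=\begin{pmatrix}\overline{a_s}&-\overline{1}\\ \overline{1}&\overline{0}\end{pmatrix}\begin{pmatrix}\overline{a_{s-1}}&-\overline{1}\\ \overline{1}&\overline{0}\end{pmatrix}\cdots\begin{pmatrix}\overline{a_1}&-\overline{1}\\ \overline{1}&\overline{0}\end{pmatrix}.$$ A solution of $(E_N)$ of size $s$ ($s\geq 1$) is an $s$-tuple $(\overline{a_1},\ldots,\overline{a_s})\in(\mathbb{Z}/N\mathbb{Z})^s$ with $M_s(\overline{a_1},\ldots,\overline{a_s})=\pm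 \mathrm{Id}$ over $\mathbb{Z}/N\mathbb{Z}$. Monomial minimal solutions: for $\overline{k}\in\mathbb{Z}/N\mathbb{Z}$, the $\overline{k}$-monomial minimal solution of $(E_N)$ is the tuple $(\overline{k},\ldots,\overline{k})$ of size $s$, where $s\geq 1$ is the smallest integer such that the $s$-tuple with all entries equal to $\overline{k}$ is a solution of $(E_N)$ (it exists and is unique). A monomial minimal solution is a $\overline{k}$-monomial minimal solution for some $\overline{k}\in\mathbb{Z}/N\mathbb{Z}$. Sum of tuples: $(\overline{a_1},\ldots,\overline{a_m})\oplus(\overline{b_1},\ldots,\overline{b_l})=(\overline{a_1+b_l},\overline{a_2},\ldots,\overline{a_{m-1}},\overline{a_m+b_1},\overline{b_2},\ldots,\overline{b_{l-1}})$, an $(m+l-2)$-tuple. Equivalence: $(\overline{a_1},\ldots,\overline{a_s})\sim(\overline{b_1},\ldots,\overline{b_s})$ if $(\overline{b_1},\ldots,\overline{b_s})$ is obtained by a cyclic permutation of $(\overline{a_1},\ldots,\overline{a_s})$ or of $(\overline{a_s},\ldots,\overline{a_1})$. Irreducibility: a solution $(\overline{c_1},\ldots,\overline{c_s})$ of $(E_N)$ with $s\geq 3$ is reducible if there exist a solution $(\overline{b_1},\ldots,\overline{b_l})$ of $(E_N)$ and an $m$-tuple $(\overline{a_1},\ldots,\overline{a_m})$ of elements of $\mathbb{Z}/N\mathbb{Z}$ with $m\geq 3$, $l\geq 3$ and $(\overline{c_1},\ldots,\overline{c_s})\sim(\overline{a_1},\ldots,\overline{a_m})\oplus(\overline{b_1},\ldots,\overline{b_l})$.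 A solution is irreducible if it is not reducible; by convention $(\overline{0},\overline{0})$ (the only solution of size 2) is not considered irreducible. There is no solution of size 1. $\varphi$ is Euler's totient function. -}

module Defs where

open import Data.Fin.Base using (Fin; toℕ; fromℕ<; combine)
open import Data.Fin.Properties
  using (pigeonhole; combine-injective; fromℕ<-injective)
open import Data.Integer.Base
  using (ℤ; +_; 0ℤ; 1ℤ; _+_; _-_; _*_; -_)
open import Data.Integer.DivMod using (_%ℕ_; _/ℕ_; n%ℕd<d; a≡a%ℕn+[a/ℕn]*n)
open import Data.Integer.Divisibility.Signed
open import Data.Integer.Properties using (+-inverseʳ)
open import Data.Integer.Tactic.RingSolver using (solve-∀)
open import Data.List.Base using (length; filter; applyUpTo)
open import Data.Nat.Base as ℕ using (ℕ; zero; suc; z≤n; s≤s; NonTrivial)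
open import Data.Nat.Coprimality using (coprime?)
import Data.Nat.Properties as ℕ
open import Data.Product using (Σ; ∃; ∃₂; ∃-syntax; _×_; _,_; proj₁; proj₂)
open import Data.Sum using (_⊎_; inj₁; inj₂)
open import Data.Vec.Base
  using (Vec; []; _∷_; _++_; init; last; reverse; replicate)
import Data.Vec.Relation.Binary.Equality.Setoid as VecEquality
open import Function.Bundles using (Bijection)
open import Level using (0ℓ)
open import Relation.Binary.Bundles using (Setoid)
import Relation.Binary.Construct.On as On
open import Relation.Binary.PropositionalEquality
  using (_≡_; sym; cong; subst)
import Relation.Binary.PropositionalEquality as ≡
open import Relation.Nullary using (¬_; Dec; yes; no; contradiction)
open import Relation.Nullary.Decidable using (map′; _×-dec_; _⊎-dec_)
open import Relation.Unary using (Pred; Decidable)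

-- ℤ/Nℤ is the setoid of integers modulo congruence; a tuple over ℤ/Nℤ is a
-- vector of integers, and two tuples are the same when they have the same
-- length and congruent entries (the relation _≋_ below).

infix 4 _≈_[mod_]

record _≈_[mod_] (a b : ℤ) (N : ℕ) : Set where
  constructor congruent
  field
    modulus∣difference : + N ∣ a - b

open _≈_[mod_] public

private
  diff-sym : ∀ a b → - (a - b) ≡ b - a
  diff-sym = solve-∀

  diff-trans : ∀ a b c → (a - b) + (b - c) ≡ a - c
  diff-trans = solve-∀

ℤ/ : ℕ → Setoid 0ℓ 0ℓ
ℤ/ N = record
  { Carrier = ℤ
  ; _≈_ = _≈_[mod N ]
  ; isEquivalence = record
    { refl  = λ {a} → congruent (divides 0ℤ (+-inverseʳ a))
    ; sym   = λ { {a} {b} (congruent p) →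
        congruent (subst (+ N ∣_) (diff-sym a b) (∣m⇒∣-m p)) }
    ; trans = λ { {a} {b} {c} (congruent p) (congruent q) →
        congruent (subst (+ N ∣_) (diff-trans a b c) (∣m∣n⇒∣m+n p q)) }
    }
  }

record Matrix₂ : Set where
  constructor mat
  field
    e₁₁ e₁₂ e₂₁ e₂₂ : ℤ

infixl 7 _·_

_·_ : Matrix₂ → Matrix₂ → Matrix₂
mat a b c d · mat a′ b′ c′ d′ =
  mat (a * a′ + b * c′) (a * b′ + b * d′)
      (c * a′ + d * c′) (c * b′ + d * d′)

Id -Id : Matrix₂
Id  = mat 1ℤ 0ℤ 0ℤ 1ℤ
-Id = mat (- 1ℤ) 0ℤ 0ℤ (- 1ℤ)

elementary : ℤ → Matrix₂
elementary a = mat a (- 1ℤ) 1ℤ 0ℤ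

-- The first entry of the tuple gives the rightmost factor.
M : ∀ {s} → Vec ℤ s → Matrix₂
M []       = Id
M (a ∷ as) = M as · elementary a

infix 5 _⊕_

-- An m-tuple and an l-tuple with m, l ≥ 2 give an (m + l − 2)-tuple; here
-- m = 2 + i and l = 2 + j.
_⊕_ : ∀ {i j} → Vec ℤ (2 ℕ.+ i) → Vec ℤ (2 ℕ.+ j) → Vec ℤ (suc (i ℕ.+ suc j))
(a₁ ∷ as) ⊕ (b₁ ∷ bs) =
  (a₁ + last bs) ∷ (init as ++ (last as + b₁) ∷ init bs)

module _ (N : ℕ) where

  open VecEquality (ℤ/ N) using (_≋_; ≋-refl; ≋-sym; ≋-trans)

  infix 4 _≈ₘ_ _∼_

  _≈ₘ_ : Matrix₂ → Matrix₂ → Set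
  mat a b c d ≈ₘ mat a′ b′ c′ d′ =
    a ≈ a′ [mod N ] × b ≈ b′ [mod N ] × c ≈ c′ [mod N ] × d ≈ d′ [mod N ]

  IsSolution : ∀ {s} → Vec ℤ s → Set
  IsSolution {s} a = 1 ℕ.≤ s × (M a ≈ₘ Id ⊎ M a ≈ₘ -Id)

  CyclicPermutation : ∀ {s t} → Vec ℤ s → Vec ℤ t → Set
  CyclicPermutation a b =
    ∃₂ λ i j → Σ (Vec ℤ i) λ u → Σ (Vec ℤ j) λ v → a ≋ u ++ v × b ≋ v ++ u

  -- The two lengths are not required to be definitionally equal, but the
  -- relation forces them to be equal.
  _∼_ : ∀ {s t} → Vec ℤ s → Vec ℤ t → Set
  a ∼ b = CyclicPermutation a b ⊎ CyclicPermutation (reverse a) b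

  Reducible : ∀ {s} → Vec ℤ s → Set
  Reducible {s} c =
    3 ℕ.≤ s ×
    (∃₂ λ i j → Σ (Vec ℤ (3 ℕ.+ i)) λ a → Σ (Vec ℤ (3 ℕ.+ j)) λ b →
       IsSolution b × c ∼ (a ⊕ b))

  Irreducible : ∀ {s} → Vec ℤ s → Set
  Irreducible c = IsSolution c × ¬ Reducible c × ¬ (c ≋ 0ℤ ∷ 0ℤ ∷ [])

  IsMinimalSize : ℤ → ℕ → Set
  IsMinimalSize k s =
    IsSolution (replicate s k) × (∀ t → IsSolution (replicate t k) → s ℕ.≤ t)

  tupleSetoid : Setoid 0ℓ 0ℓ
  tupleSetoid = record
    { Carrier = ∃ (Vec ℤ)
    ; _≈_ = λ (_ , a) (_ , b) → a ≋ b
    ; isEquivalence = record { refl = ≋-refl ; sym = ≋-sym ; trans = ≋-trans }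
    }

  -- Tuples are counted as elements of (ℤ/Nℤ)ˢ, s ≥ 0, not up to _∼_.
  HasExactly : ℕ → (∃ (Vec ℤ) → Set) → Set
  HasExactly m P =
    Bijection (≡.setoid (Fin m)) (On.setoid tupleSetoid (proj₁ {B = P}))

  -- Existence of the minimal size: by the pigeonhole principle two powers of
  -- the elementary matrix of k are congruent modulo N, and right factors can
  -- be cancelled.

  private
    power : ℤ → ℕ → Matrix₂
    power k s = M (replicate s k)

    module Z = Setoid (ℤ/ N)

    minus-swap : ∀ a b a′ b′ →
      (a′ * - 1ℤ + b′ * 0ℤ) - (a * - 1ℤ + b * 0ℤ) ≡ a - a′
    minus-swap = solve-∀

    row-cancel : ∀ a b a′ b′ k →
      ((a * k + b * 1ℤ) - (a′ * k + b′ * 1ℤ)) - (a - a′) * k ≡ b - b′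
    row-cancel = solve-∀

    cancelRow : ∀ a b a′ b′ k →
      a * k + b * 1ℤ ≈ a′ * k + b′ * 1ℤ [mod N ] →
      a * - 1ℤ + b * 0ℤ ≈ a′ * - 1ℤ + b′ * 0ℤ [mod N ] →
      a ≈ a′ [mod N ] × b ≈ b′ [mod N ]
    cancelRow a b a′ b′ k p q = a≈a′ ,
      congruent (subst (+ N ∣_) (row-cancel a b a′ b′ k)
        (∣m∣n⇒∣m-n (modulus∣difference p)
                   (∣m⇒∣m*n k (modulus∣difference a≈a′))))
      where
      a≈a′ : a ≈ a′ [mod N ]
      a≈a′ = congruent
        (subst (+ N ∣_) (minus-swap a b a′ b′) (modulus∣difference (Z.sym q)))

    cancelʳ : ∀ X Y k → X · elementary k ≈ₘ Y · elementary k → X ≈ₘ Y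
    cancelʳ (mat a b c d) (mat a′ b′ c′ d′) k (p , q , r , s) =
      let a≈ , b≈ = cancelRow a b a′ b′ k p q
          c≈ , d≈ = cancelRow c d c′ d′ k r s
      in a≈ , b≈ , c≈ , d≈

    ≈ₘ-sym : ∀ X Y → X ≈ₘ Y → Y ≈ₘ X
    ≈ₘ-sym _ _ (p , q , r , s) = Z.sym p , Z.sym q , Z.sym r , Z.sym s

    period : ∀ k i j → i ℕ.< j → power k i ≈ₘ power k j →
      ∃[ s ] 1 ℕ.≤ s × power k s ≈ₘ Id
    period k zero    j       0<j p = j , 0<j , ≈ₘ-sym Id (power k j) p
    period k (suc i) (suc j) (s≤s i<j) p =
      period k i j i<j (cancelʳ (power k i) (power k j) k p)

    ≈? : ∀ a b → Dec (a ≈ b [mod N ])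
    ≈? a b = map′ congruent modulus∣difference (+ N ∣? a - b)

    ≈ₘ? : ∀ X Y → Dec (X ≈ₘ Y)
    ≈ₘ? (mat a b c d) (mat a′ b′ c′ d′) =
      ≈? a a′ ×-dec ≈? b b′ ×-dec ≈? c c′ ×-dec ≈? d d′

    isSolution? : ∀ {s} (a : Vec ℤ s) → Dec (IsSolution a)
    isSolution? {s} a = (1 ℕ.≤? s) ×-dec (≈ₘ? (M a) Id ⊎-dec ≈ₘ? (M a) -Id)

    Least : Pred ℕ 0ℓ → Pred ℕ 0ℓ
    Least P s = P s × (∀ t → P t → s ℕ.≤ t)

    least : ∀ {P : Pred ℕ 0ℓ} → Decidable P → ∀ s → P s → ∃ (Least P)
    least P? s Ps with P? zero
    ... | yes P0 = zero , P0 , λ _ _ → z≤n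
    least P? zero    Ps | no ¬P0 = contradiction Ps ¬P0
    least P? (suc s) Ps | no ¬P0 with least (λ t → P? (suc t)) s Ps
    ... | m , Pm , m-least = suc m , Pm ,
      λ { zero P0 → contradiction P0 ¬P0 ; (suc t) Pt → s≤s (m-least t Pt) }

  module _ .{{_ : NonTrivial N}} where

    private
      instance
        nonZero : ℕ.NonZero N
        nonZero = ℕ.nonTrivial⇒nonZero N

      residue : ℤ → Fin N
      residue a = fromℕ< (n%ℕd<d a N)

      same-remainder : ∀ r q q′ n → (r + q * n) - (r + q′ * n) ≡ (q - q′) * n
      same-remainder = solve-∀

      residue-injective : ∀ a b → residue a ≡ residue b → a ≈ b [mod N ]
      residue-injective a b eq = congruent (divides (a /ℕ N - b /ℕ N) (begin
        a - b
          ≡⟨ ≡.cong₂ _-_ (a≡a%ℕn+[a/ℕn]*n a N) (a≡a%ℕn+[a/ℕn]*n b N) ⟩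
        (+ (a %ℕ N) + (a /ℕ N) * + N) - (+ (b %ℕ N) + (b /ℕ N) * + N)
          ≡⟨ cong (λ r → (+ (a %ℕ N) + (a /ℕ N) * + N) - (+ r + (b /ℕ N) * + N))
               (sym (fromℕ<-injective _ _ (n%ℕd<d a N) (n%ℕd<d b N) eq)) ⟩
        (+ (a %ℕ N) + (a /ℕ N) * + N) - (+ (a %ℕ N) + (b /ℕ N) * + N)
          ≡⟨ same-remainder (+ (a %ℕ N)) (a /ℕ N) (b /ℕ N) (+ N) ⟩
        (a /ℕ N - b /ℕ N) * + N ∎))
        where open ≡.≡-Reasoning

      encode : Matrix₂ → Fin ((N ℕ.* N) ℕ.* (N ℕ.* N))
      encode (mat a b c d) =
        combine (combine (residue a) (residue b))
                (combine (residue c) (residue d))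

      encode-injective : ∀ X Y → encode X ≡ encode Y → X ≈ₘ Y
      encode-injective (mat a b c d) (mat a′ b′ c′ d′) eq
        with ab , cd ← combine-injective
               (combine (residue a) (residue b)) (combine (residue c) (residue d))
               (combine (residue a′) (residue b′)) (combine (residue c′) (residue d′)) eq
        with p , q ← combine-injective (residue a) (residue b) (residue a′) (residue b′) ab
           | r , s ← combine-injective (residue c) (residue d) (residue c′) (residue d′) cd
        = residue-injective a a′ p , residue-injective b b′ q ,
          residue-injective c c′ r , residue-injective d d′ s

    -- Abstract because unfolding the search is expensive; the specification
    -- determines its first component.
    abstract
      minimalSize-exists : ∀ k → ∃ (IsMinimalSize k)
      minimalSize-exists k =
        let i , j , i<j , eq = pigeonhole (ℕ.n<1+n ((N ℕ.* N) ℕ.* (N ℕ.* N)))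
                                 (λ i → encode (power k (toℕ i)))
            s , 1≤s , p = period k (toℕ i) (toℕ j) i<j
              (encode-injective (power k (toℕ i)) (power k (toℕ j)) eq)
        in least (λ t → isSolution? (replicate t k)) s (1≤s , inj₁ p)

    minimalSize : ℤ → ℕ
    minimalSize k = proj₁ (minimalSize-exists k)

    minimalSize-isMinimal : ∀ k → IsMinimalSize k (minimalSize k)
    minimalSize-isMinimal k = proj₂ (minimalSize-exists k)

    minimalSize-unique : ∀ k s → IsMinimalSize k s → s ≡ minimalSize k
    minimalSize-unique k s (sol , min) =
      ℕ.≤-antisym (min (minimalSize k) (proj₁ (minimalSize-isMinimal k)))
                  (proj₂ (minimalSize-isMinimal k) s sol)

    monomialMinimalSolution : (k : ℤ) → Vec ℤ (minimalSize k)
    monomialMinimalSolution k = replicate (minimalSize k) k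

    IsMonomialMinimalSolution : ∀ {s} → Vec ℤ s → Set
    IsMonomialMinimalSolution c = ∃[ k ] c ≋ monomialMinimalSolution k

    IrreducibleMonomialMinimal : ∃ (Vec ℤ) → Set
    IrreducibleMonomialMinimal (_ , c) =
      IsMonomialMinimalSolution c × Irreducible c

φ : ℕ → ℕ
φ n = length (filter (λ i → coprime? i n) (applyUpTo suc n))

Odd : ℤ → Set
Odd a = ¬ (+ 2 ∣ a)

-- Write E for the elementary matrix of k. Then E ^ t = v_t Id + u_t E for a pair of
-- Chebyshev sequences, and the tuple (k, …, k) of size t is a solution modulo N
-- exactly when u_t ≡ 0 and v_t ≡ ±1. The tuple b in a decomposition a ⊕ b of a constant
-- tuple has the form (x, k, …, k, y), and x, y making it a solution exist exactly when
-- u_j ≡ ±1, where b has length j + 1. So the k-monomial solution of minimal size s is reducible iff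
-- u_j ≡ ±1 for some 2 ≤ j ≤ s − 2.
--
-- For p ∤ k, u_j² − 1 = u_{j−1} u_{j+1} and u_{j−1} + u_{j+1} = k u_j show that N
-- divides u_{j−1} or u_{j+1}, which gives a solution of size j ± 1 < s. For p ∣ k, lifting
-- the exponent along multiples of an index shows that p ∣ s / 2 and N / p ∣ u_{s/p},
-- so for odd p one can take j = 1 + s / p. For p = 2 the factorisations of u_{2t+1} ∓ 1
-- settle all cases: if 4 ∣ k and N / 2 ∤ k then j = 1 + s / 2 works; if k is twice an odd
-- number, the factors 2 v_t + k u_t are twice odd numbers and u_j ≡ ±1 again produces a
-- smaller solution; and k ≡ N / 2 gives s = 4.

module Submission where

open import Defs

module MonomialSolutions where

  open import Data.Fin.Base using (Fin; zero; suc)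
  open import Data.Integer.Base as ℤ using (ℤ; +_; 0ℤ; 1ℤ; _+_; _*_; -_; _-_; _^_)
  open import Data.Integer.DivMod using (_%ℕ_; _/ℕ_; n%ℕd<d; a≡a%ℕn+[a/ℕn]*n)
  open import Data.Integer.Divisibility.Signed
  import Data.Integer.Properties as ℤ
  open import Data.Integer.Tactic.RingSolver using (solve-∀)
  open import Data.List.Base as List
    using (List; []; _∷_; length; filter; applyUpTo; lookup)
  open import Data.List.Membership.Propositional using (_∈_)
  open import Data.List.Membership.Propositional.Properties
    using (∈-lookup; ∈-filter⁺; ∈-filter⁻; ∈-applyUpTo⁺; ∈-applyUpTo⁻)
  import Data.List.Properties as List
  import Data.List.Relation.Unary.All as ListAll
  import Data.List.Relation.Unary.All.Properties as ListAll
  open import Data.List.Relation.Unary.Any using (here; there; index)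
  open import Data.List.Relation.Unary.Any.Properties using (lookup-index)
  open import Data.List.Relation.Unary.Unique.Propositional using (Unique; _∷_)
  import Data.List.Relation.Unary.Unique.Propositional.Properties as Unique
  open import Data.Nat.Base as ℕ
    using (ℕ; zero; suc; _≤_; _<_; s≤s; z≤n; NonTrivial; NonZero)
  open import Data.Nat.Coprimality using (Coprime; coprime?; coprime-divisor)
  import Data.Nat.Divisibility as ℕ
  open import Data.Nat.Primality
    using (Prime; prime[2]; ¬prime[1]; irreducible[2]; euclidsLemma;
           prime⇒irreducible; prime⇒nonZero; prime⇒nonTrivial)
  import Data.Nat.Properties as ℕ
  open import Data.Nat.Tactic.RingSolver renaming (solve-∀ to solveℕ-∀)
  open import Data.Product using (∃; ∃-syntax; _×_; _,_; proj₁; proj₂)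
  open import Data.Sum as Sum using (_⊎_; inj₁; inj₂; [_,_]′)
  open import Data.Vec.Base
    using (Vec; []; _∷_; _∷ʳ_; _++_; init; last; replicate; reverse)
  import Data.Vec.Properties as Vec
  import Data.Vec.Relation.Binary.Equality.Setoid as VecEquality
  open import Data.Vec.Relation.Unary.All using (All; []; _∷_)
  import Data.Vec.Relation.Unary.All.Properties as All
  open import Function.Base using (id; _∘_)
  open import Function.Bundles using (_⇔_; mk⇔; Equivalence)
  open import Relation.Binary.Bundles using (Setoid)
  open import Relation.Binary.PropositionalEquality
    using (_≡_; _≢_; refl; sym; trans; cong; cong₂; subst; module ≡-Reasoning)
  open import Relation.Nullary using (¬_; contradiction; yes; no)
  open import Relation.Nullary.Decidable using (¬?)
  open import Relation.Unary using (Decidable)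

  -- Chebyshev sequences and products of elementary matrices.

  ∣-linear₁ : ∀ {d a c} x → d ∣ a → c ≡ x * a → d ∣ c
  ∣-linear₁ x d∣a refl = ∣n⇒∣m*n x d∣a

  ∣-linear₂ : ∀ {d a b c} x y → d ∣ a → d ∣ b → c ≡ x * a + y * b → d ∣ c
  ∣-linear₂ x y d∣a d∣b refl = ∣m∣n⇒∣m+n (∣n⇒∣m*n x d∣a) (∣n⇒∣m*n y d∣b)

  -- The Chebyshev pair: elementary k ^ t = v k t Id + u k t elementary k.
  mutual
    u : ℤ → ℕ → ℤ
    u k zero    = 0ℤ
    u k (suc t) = v k t + k * u k t

    v : ℤ → ℕ → ℤ
    v k zero    = 1ℤ
    v k (suc t) = - u k t

  -- The left side is the determinant of the t-th power of `elementary k`, in the form given by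
  -- `M-replicate`.
  det≡1 : ∀ k t → v k t * u k (suc t) + u k t * u k t ≡ 1ℤ
  det≡1 k zero    = base k
    where
    base : ∀ k → 1ℤ * (1ℤ + k * 0ℤ) + 0ℤ * 0ℤ ≡ 1ℤ
    base = solve-∀
  det≡1 k (suc t) = trans (step k (u k t) (v k t)) (det≡1 k t)
    where
    step : ∀ k u v → - u * (- u + k * (v + k * u)) + (v + k * u) * (v + k * u)
                   ≡ v * (v + k * u) + u * u
    step = solve-∀

  -- With E = `elementary k`, expand (v_a + u_a E)(v_b + u_b E) and reduce by E² = k E - Id.
  uv-+ : ∀ k a b →
    u k (a ℕ.+ b) ≡ v k a * u k b + u k a * v k b + k * (u k a * u k b) ×
    v k (a ℕ.+ b) ≡ v k a * v k b - u k a * u k b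
  uv-+ k zero b = base₁ k (u k b) (v k b) , base₂ (u k b) (v k b)
    where
    base₁ : ∀ k u v → u ≡ 1ℤ * u + 0ℤ * v + k * (0ℤ * u)
    base₁ = solve-∀
    base₂ : ∀ u v → v ≡ 1ℤ * v - 0ℤ * u
    base₂ = solve-∀
  uv-+ k (suc a) b with uv-+ k a b
  ... | p , q = trans (cong₂ (λ x y → y + k * x) p q)
                  (step₁ k (u k a) (v k a) (u k b) (v k b))
              , trans (cong -_ p) (step₂ k (u k a) (v k a) (u k b) (v k b))
    where
    step₁ : ∀ k u v u′ v′ →
      v * v′ - u * u′ + k * (v * u′ + u * v′ + k * (u * u′)) ≡
      - u * u′ + (v + k * u) * v′ + k * ((v + k * u) * u′)
    step₁ = solve-∀
    step₂ : ∀ k u v u′ v′ →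
      - (v * u′ + u * v′ + k * (u * u′)) ≡ - u * v′ - (v + k * u) * u′
    step₂ = solve-∀

  u-+ : ∀ k a b →
    u k (a ℕ.+ b) ≡ v k a * u k b + u k a * v k b + k * (u k a * u k b)
  u-+ k a b = proj₁ (uv-+ k a b)

  v-+ : ∀ k a b → v k (a ℕ.+ b) ≡ v k a * v k b - u k a * u k b
  v-+ k a b = proj₂ (uv-+ k a b)

  mat-cong : ∀ {a b c d a′ b′ c′ d′} → a ≡ a′ → b ≡ b′ → c ≡ c′ → d ≡ d′ →
    mat a b c d ≡ mat a′ b′ c′ d′
  mat-cong refl refl refl refl = refl

  M-replicate : ∀ k t → M (replicate t k) ≡ mat (u k (suc t)) (- u k t) (u k t) (v k t)
  M-replicate k zero    = mat-cong (base k) refl refl refl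
    where
    base : ∀ k → 1ℤ ≡ 1ℤ + k * 0ℤ
    base = solve-∀
  M-replicate k (suc t) =
    trans (cong (_· elementary k) (M-replicate k t))
      (mat-cong (p k (u k t) (v k t)) (q k (u k t) (v k t)) (r k (u k t) (v k t)) (s (u k t) (v k t)))
    where
    p : ∀ k u v → (v + k * u) * k + - u * 1ℤ ≡ - u + k * (v + k * u)
    p = solve-∀
    q : ∀ k u v → (v + k * u) * - 1ℤ + - u * 0ℤ ≡ - (v + k * u)
    q = solve-∀
    r : ∀ k u v → u * k + v * 1ℤ ≡ v + k * u
    r = solve-∀
    s : ∀ u v → u * - 1ℤ + v * 0ℤ ≡ - u
    s = solve-∀

  -- `M` peels entries off the front only; this gives access to the last entry, needed to isolate
  -- both ends of a summand of `⊕`.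
  M-∷ʳ : ∀ {s} (as : Vec ℤ s) y → M (as ∷ʳ y) ≡ elementary y · M as
  M-∷ʳ []       y = mat-cong (p y) (q y) refl refl
    where
    p : ∀ y → 1ℤ * y + 0ℤ * 1ℤ ≡ y * 1ℤ + - 1ℤ * 0ℤ
    p = solve-∀
    q : ∀ y → 1ℤ * - 1ℤ + 0ℤ * 0ℤ ≡ y * 0ℤ + - 1ℤ * 1ℤ
    q = solve-∀
  M-∷ʳ (a ∷ as) y = trans (cong (_· elementary a) (M-∷ʳ as y)) (assoc (M as))
    where
    assocEntry : ∀ x z b c d e f g →
      (x * b + z * d) * f + (x * c + z * e) * g ≡
      x * (b * f + c * g) + z * (d * f + e * g)
    assocEntry = solve-∀
    assoc : ∀ X → elementary y · X · elementary a ≡ elementary y · (X · elementary a)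
    assoc (mat b c d e) = mat-cong
      (assocEntry y (- 1ℤ) b c d e a 1ℤ) (assocEntry y (- 1ℤ) b c d e (- 1ℤ) 0ℤ)
      (assocEntry 1ℤ 0ℤ b c d e a 1ℤ) (assocEntry 1ℤ 0ℤ b c d e (- 1ℤ) 0ℤ)

  init∷ʳlast : ∀ {A : Set} {n} (xs : Vec A (suc n)) → init xs ∷ʳ last xs ≡ xs
  init∷ʳlast (x ∷ [])     = refl
  init∷ʳlast (x ∷ y ∷ xs) = cong (x ∷_) (init∷ʳlast (y ∷ xs))

  ∷ʳ-⊕-∷ʳ : ∀ {i j} a (as : Vec ℤ i) a′ b (bs : Vec ℤ j) b′ →
    (a ∷ (as ∷ʳ a′)) ⊕ (b ∷ (bs ∷ʳ b′)) ≡ (a + b′) ∷ (as ++ (a′ + b) ∷ bs)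
  ∷ʳ-⊕-∷ʳ a as a′ b bs b′ = cong₂ _∷_ (cong (λ c → a + c) (Vec.last-∷ʳ b′ bs))
    (cong₂ _++_ (Vec.init-∷ʳ a′ as)
      (cong₂ _∷_ (cong (_+ b) (Vec.last-∷ʳ a′ as)) (Vec.init-∷ʳ b′ bs)))

  reverse-replicate : ∀ {A : Set} s (x : A) → reverse (replicate s x) ≡ replicate s x
  reverse-replicate zero    x = refl
  reverse-replicate (suc s) x =
    trans (Vec.reverse-∷ x (replicate s x))
      (trans (cong (_∷ʳ x) (reverse-replicate s x)) (replicate-∷ʳ s))
    where
    replicate-∷ʳ : ∀ s → replicate s x ∷ʳ x ≡ x ∷ replicate s x
    replicate-∷ʳ zero    = refl
    replicate-∷ʳ (suc s) = cong (x ∷_) (replicate-∷ʳ s)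

  -- Congruences of integers, matrices and tuples modulo N.

  module _ (N : ℕ) where

    open VecEquality (ℤ/ N)
    open Setoid (ℤ/ N) using () renaming (refl to ≈-refl; sym to ≈-sym; trans to ≈-trans)

    ≈0⇒∣ : ∀ {x} → x ≈ 0ℤ [mod N ] → + N ∣ x
    ≈0⇒∣ {x} (congruent p) = subst (+ N ∣_) (ℤ.+-identityʳ x) p

    ∣⇒≈0 : ∀ {x} → + N ∣ x → x ≈ 0ℤ [mod N ]
    ∣⇒≈0 {x} p = congruent (subst (+ N ∣_) (sym (ℤ.+-identityʳ x)) p)

    ≡⇒≈ : ∀ {x y} → x ≡ y → x ≈ y [mod N ]
    ≡⇒≈ refl = ≈-refl

    +-cong : ∀ {a b c d} → a ≈ b [mod N ] → c ≈ d [mod N ] → a + c ≈ b + d [mod N ]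
    +-cong {a} {b} {c} {d} (congruent p) (congruent q) =
      congruent (subst (+ N ∣_) (eq a b c d) (∣m∣n⇒∣m+n p q))
      where
      eq : ∀ a b c d → (a - b) + (c - d) ≡ a + c - (b + d)
      eq = solve-∀

    *-cong : ∀ {a b c d} → a ≈ b [mod N ] → c ≈ d [mod N ] → a * c ≈ b * d [mod N ]
    *-cong {a} {b} {c} {d} (congruent p) (congruent q) =
      congruent (∣-linear₂ c b p q (eq a b c d))
      where
      eq : ∀ a b c d → a * c - b * d ≡ c * (a - b) + b * (c - d)
      eq = solve-∀

    neg-cong : ∀ {a b} → a ≈ b [mod N ] → - a ≈ - b [mod N ]
    neg-cong {a} {b} (congruent p) = congruent (∣-linear₁ (- 1ℤ) p (eq a b))
      where
      eq : ∀ a b → - a - - b ≡ - 1ℤ * (a - b)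
      eq = solve-∀

    ·-cong : ∀ X Y Z W → _≈ₘ_ N X Y → _≈ₘ_ N Z W → _≈ₘ_ N (X · Z) (Y · W)
    ·-cong _ _ _ _ (a , b , c , d) (a′ , b′ , c′ , d′) =
      +-cong (*-cong a a′) (*-cong b c′) , +-cong (*-cong a b′) (*-cong b d′) ,
      +-cong (*-cong c a′) (*-cong d c′) , +-cong (*-cong c b′) (*-cong d d′)

    ≡⇒≈ₘ : ∀ {X Y} → X ≡ Y → _≈ₘ_ N X Y
    ≡⇒≈ₘ refl = ≈-refl , ≈-refl , ≈-refl , ≈-refl

    ≈ₘ-trans : ∀ X Y Z → _≈ₘ_ N X Y → _≈ₘ_ N Y Z → _≈ₘ_ N X Z
    ≈ₘ-trans _ _ _ (a , b , c , d) (a′ , b′ , c′ , d′) =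
      ≈-trans a a′ , ≈-trans b b′ , ≈-trans c c′ , ≈-trans d d′

    M-cong : ∀ {s t} {a : Vec ℤ s} {b : Vec ℤ t} → a ≋ b → _≈ₘ_ N (M a) (M b)
    M-cong [] = ≡⇒≈ₘ {Id} refl
    M-cong {a = x ∷ as} {y ∷ bs} (x≈y ∷ as≋bs) =
      ·-cong (M as) (M bs) (elementary x) (elementary y) (M-cong as≋bs)
        (x≈y , ≈-refl , ≈-refl , ≈-refl)

    IsSolution-resp : ∀ {s t} {a : Vec ℤ s} {b : Vec ℤ t} → a ≋ b → IsSolution N a → IsSolution N b
    IsSolution-resp {a = a} {b} a≋b (1≤s , sol) =
      subst (1 ≤_) (length-equal a≋b) 1≤s , resp sol
      where
      Mb≈Ma : _≈ₘ_ N (M b) (M a)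
      Mb≈Ma = M-cong (≋-sym a≋b)
      resp : _≈ₘ_ N (M a) Id ⊎ _≈ₘ_ N (M a) -Id → _≈ₘ_ N (M b) Id ⊎ _≈ₘ_ N (M b) -Id
      resp (inj₁ p) = inj₁ (≈ₘ-trans (M b) (M a) Id Mb≈Ma p)
      resp (inj₂ p) = inj₂ (≈ₘ-trans (M b) (M a) -Id Mb≈Ma p)

    Sign : ℤ → Set
    Sign x = x ≈ 1ℤ [mod N ] ⊎ x ≈ - 1ℤ [mod N ]

    Sign-resp : ∀ {x y} → x ≈ y [mod N ] → Sign x → Sign y
    Sign-resp x≈y (inj₁ p) = inj₁ (≈-trans (≈-sym x≈y) p)
    Sign-resp x≈y (inj₂ p) = inj₂ (≈-trans (≈-sym x≈y) p)

    Sign-neg : ∀ {x} → Sign x → Sign (- x)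
    Sign-neg (inj₁ p) = inj₂ (neg-cong p)
    Sign-neg (inj₂ p) = inj₁ (neg-cong p)

    Sign-square : ∀ {x} → Sign x → x * x ≈ 1ℤ [mod N ]
    Sign-square (inj₁ p) = *-cong p p
    Sign-square (inj₂ p) = *-cong p p

    solution⇒u≈0 : ∀ k t → IsSolution N (replicate t k) → + N ∣ u k t
    solution⇒u≈0 k t (_ , sol) with M (replicate t k) | M-replicate k t
    solution⇒u≈0 k t (_ , inj₁ (_ , _ , p , _)) | _ | refl = ≈0⇒∣ p
    solution⇒u≈0 k t (_ , inj₂ (_ , _ , p , _)) | _ | refl = ≈0⇒∣ p

    -- The off-diagonal entries are ± `u k t`, and once these vanish the two diagonal entries agree,
    -- because `u k (suc t)` is `v k t + k * u k t`. A single sign then decides.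
    u≈0⇒solution : ∀ k t → 1 ≤ t → + N ∣ u k t → Sign (v k t) → IsSolution N (replicate t k)
    u≈0⇒solution k t 1≤t N∣u sign with M (replicate t k) | M-replicate k t
    ... | _ | refl = 1≤t , go sign
      where
      u≈0 : u k t ≈ 0ℤ [mod N ]
      u≈0 = ∣⇒≈0 N∣u
      w≈v : u k (suc t) ≈ v k t [mod N ]
      w≈v = ≈-trans (+-cong (≈-refl {v k t}) (*-cong (≈-refl {k}) u≈0)) (≡⇒≈ (eq k (v k t)))
        where
        eq : ∀ k v → v + k * 0ℤ ≡ v
        eq = solve-∀
      X : Matrix₂
      X = mat (u k (suc t)) (- u k t) (u k t) (v k t)
      go : Sign (v k t) → _≈ₘ_ N X Id ⊎ _≈ₘ_ N X -Id
      go (inj₁ p) = inj₁ (≈-trans w≈v p , neg-cong u≈0 , u≈0 , p)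
      go (inj₂ p) = inj₂ (≈-trans w≈v p , neg-cong u≈0 , u≈0 , p)

    -- Constant tuples and their decompositions.

    Constant : ∀ {s} → ℤ → Vec ℤ s → Set
    Constant k = All (_≈ k [mod N ])

    constant⇒≋ : ∀ {s} {k} {a : Vec ℤ s} → Constant k a → a ≋ replicate s k
    constant⇒≋ []       = []
    constant⇒≋ (p ∷ ps) = p ∷ constant⇒≋ ps

    ≋⇒constant : ∀ {s t} {k} {a : Vec ℤ s} → a ≋ replicate t k → Constant k a
    ≋⇒constant {t = zero}  []       = []
    ≋⇒constant {t = suc t} (p ∷ ps) = p ∷ ≋⇒constant ps

    replicate-constant : ∀ s k → Constant k (replicate s k)
    replicate-constant s k = ≋⇒constant {t = s} ≋-refl

    constant-∷ʳ : ∀ {s k y} {a : Vec ℤ s} → Constant k a → y ≈ k [mod N ] → Constant k (a ∷ʳ y)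
    constant-∷ʳ []       q = q ∷ []
    constant-∷ʳ (p ∷ ps) q = p ∷ constant-∷ʳ ps q

    -- Both pieces of a constant tuple are constant, so swapping them changes nothing: rotation acts
    -- trivially on constant tuples.
    cyclicPermutation-constant : ∀ {s t k} {d : Vec ℤ t} →
      CyclicPermutation N (replicate s k) d → s ≡ t × Constant k d
    cyclicPermutation-constant {s} {k = k} (i , j , y , z , p , q) =
        trans (length-equal p) (trans (ℕ.+-comm i j) (sym (length-equal q)))
      , ≋⇒constant (≋-trans q (constant⇒≋ (All.++⁺ (proj₂ yz) (proj₁ yz))))
      where
      yz : Constant k y × Constant k z
      yz = All.++⁻ y (≋⇒constant (≋-sym p))

    ∼-constant : ∀ {s t k} {d : Vec ℤ t} → _∼_ N (replicate s k) d → s ≡ t × Constant k d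
    ∼-constant         (inj₁ p) = cyclicPermutation-constant p
    ∼-constant {s} {k = k} {d} (inj₂ p) = cyclicPermutation-constant
      (subst (λ r → CyclicPermutation N r d) (reverse-replicate s k) p)

    -- Every b with a ⊕ b constant is (x , k , … , k , y), and the lower right
    -- entry of M b does not depend on x and y.
    reducible⇒sign : ∀ k s → Reducible N (replicate s k) →
      ∃[ i ] ∃[ j ] s ≡ 4 ℕ.+ (i ℕ.+ j) × Sign (u k (2 ℕ.+ j))
    reducible⇒sign k s (_ , i , j , a₁ ∷ as , b₁ ∷ bs , (_ , b-sol) , c∼)
      with s≡ , (_ ∷ ps) ← ∼-constant c∼
      -- Behind `init as` come the junction entry and then the inner entries of b, which are
      -- therefore all congruent to k.
      with (_ ∷ init-bs) ← All.++ʳ⁻ (init as) ps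
      = i , j , trans s≡ (len i j) , sign
      where
      len : ∀ i j → suc (suc i ℕ.+ suc (suc j)) ≡ 4 ℕ.+ (i ℕ.+ j)
      len = solveℕ-∀
      w : ℤ
      w = Matrix₂.e₁₁ (M (init bs))
      w≈u : w ≈ u k (2 ℕ.+ j) [mod N ]
      w≈u = ≈-trans (proj₁ (M-cong (constant⇒≋ init-bs)))
                    (≡⇒≈ (cong Matrix₂.e₁₁ (M-replicate k (suc j))))
      e₂₂ : ∀ X → Matrix₂.e₂₂ (elementary (last bs) · X · elementary b₁) ≡ - Matrix₂.e₁₁ X
      e₂₂ (mat a b c d) = eq a b c d
        where
        eq : ∀ a b c d → (1ℤ * a + 0ℤ * c) * - 1ℤ + (1ℤ * b + 0ℤ * d) * 0ℤ ≡ - a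
        eq = solve-∀
      Mb : M (b₁ ∷ bs) ≡ elementary (last bs) · M (init bs) · elementary b₁
      Mb = cong (_· elementary b₁)
             (trans (cong M (sym (init∷ʳlast bs))) (M-∷ʳ (init bs) (last bs)))
      e₂₂-sign : Sign (Matrix₂.e₂₂ (M (b₁ ∷ bs)))
      e₂₂-sign = Sum.map (λ (_ , _ , _ , p) → p) (λ (_ , _ , _ , p) → p) b-sol
      sign : Sign (u k (2 ℕ.+ j))
      sign = Sign-resp w≈u (subst Sign (ℤ.neg-involutive w)
        (Sign-neg (subst Sign (trans (cong Matrix₂.e₂₂ Mb) (e₂₂ (M (init bs)))) e₂₂-sign)))

    -- The middle matrix is a power of an elementary matrix with upper left entry ε. For outer
    -- entries x and y the off-diagonal entries of the product are u - x ε and ε y - u, which vanish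
    -- for x = y = ε u when ε² ≡ 1; the upper left entry then follows from the determinant.
    sandwich : ∀ ε u v → ε * ε ≈ 1ℤ [mod N ] → v * ε + u * u ≡ 1ℤ →
      _≈ₘ_ N (elementary (ε * u) · mat ε (- u) u v · elementary (ε * u)) (mat (- ε) 0ℤ 0ℤ (- ε))
    sandwich ε u v (congruent p) det =
        congruent (∣-linear₂ (ε * u * u + v) (- ε) p (divides 0ℤ (cong (_- 1ℤ) det)) (e₁₁ ε u v))
      , congruent (∣-linear₁ (- u) p (e₁₂ ε u v))
      , congruent (∣-linear₁ u p (e₂₁ ε u v))
      , ≡⇒≈ (e₂₂ ε u v)
      where
      e₁₁ : ∀ ε u v →
        ((ε * u) * ε + - 1ℤ * u) * (ε * u) + ((ε * u) * - u + - 1ℤ * v) * 1ℤ - - ε ≡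
        (ε * u * u + v) * (ε * ε - 1ℤ) + - ε * (v * ε + u * u - 1ℤ)
      e₁₁ = solve-∀
      e₁₂ : ∀ ε u v →
        ((ε * u) * ε + - 1ℤ * u) * - 1ℤ + ((ε * u) * - u + - 1ℤ * v) * 0ℤ - 0ℤ ≡
        - u * (ε * ε - 1ℤ)
      e₁₂ = solve-∀
      e₂₁ : ∀ ε u v →
        (1ℤ * ε + 0ℤ * u) * (ε * u) + (1ℤ * - u + 0ℤ * v) * 1ℤ - 0ℤ ≡ u * (ε * ε - 1ℤ)
      e₂₁ = solve-∀
      e₂₂ : ∀ ε u v → (1ℤ * ε + 0ℤ * u) * - 1ℤ + (1ℤ * - u + 0ℤ * v) * 0ℤ ≡ - ε
      e₂₂ = solve-∀

    scalar-solution : ∀ X ε → _≈ₘ_ N X (mat (- ε) 0ℤ 0ℤ (- ε)) → Sign ε →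
      _≈ₘ_ N X Id ⊎ _≈ₘ_ N X -Id
    scalar-solution _ _ (p , q , r , s) (inj₁ e) =
      inj₂ (≈-trans p (neg-cong e) , q , r , ≈-trans s (neg-cong e))
    scalar-solution _ _ (p , q , r , s) (inj₂ e) =
      inj₁ (≈-trans p (neg-cong e) , q , r , ≈-trans s (neg-cong e))

    -- With ε = u k (2 + j) ≡ ±1, the tuple (ε u , k , … , k , ε u) for
    -- u = u k (1 + j) is a solution.
    sign⇒reducible : ∀ {s} (c : Vec ℤ s) k i j → c ≋ replicate (4 ℕ.+ (i ℕ.+ j)) k →
      Sign (u k (2 ℕ.+ j)) → Reducible N c
    sign⇒reducible {s} c k i j c≋ sign =
        subst (3 ≤_) (sym (length-equal c≋)) (s≤s (s≤s (s≤s z≤n)))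
      , i , j , (k - x) ∷ as , x ∷ bs , (s≤s z≤n , b-solution)
      , inj₁ (s , 0 , c , [] , ≋-sym (++-identityʳ c) , a⊕b≋c)
      where
      ε x : ℤ
      ε = u k (2 ℕ.+ j)
      x = ε * u k (suc j)
      -- The first summand has ends k - x, to compensate the ends x of b at both junctions.
      as : Vec ℤ (2 ℕ.+ i)
      as = replicate (suc i) k ∷ʳ (k - x)
      bs : Vec ℤ (2 ℕ.+ j)
      bs = replicate (suc j) k ∷ʳ x
      cancel : k - x + x ≡ k
      cancel = eq k x
        where
        eq : ∀ k x → k - x + x ≡ k
        eq = solve-∀
      a⊕b-constant : Constant k (((k - x) ∷ as) ⊕ (x ∷ bs))
      a⊕b-constant = subst (Constant k)
        (sym (∷ʳ-⊕-∷ʳ (k - x) (replicate (suc i) k) (k - x) x (replicate (suc j) k) x))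
        (≡⇒≈ cancel ∷ All.++⁺ (replicate-constant (suc i) k)
          (≡⇒≈ cancel ∷ replicate-constant (suc j) k))
      len : ∀ i j → suc (suc i ℕ.+ suc (suc j)) ≡ 4 ℕ.+ (i ℕ.+ j)
      len = solveℕ-∀
      a⊕b≋c : ((k - x) ∷ as) ⊕ (x ∷ bs) ≋ c
      a⊕b≋c = ≋-trans (constant⇒≋ a⊕b-constant)
        (≋-sym (subst (λ n → c ≋ replicate n k) (sym (len i j)) c≋))
      uⱼ vⱼ : ℤ
      uⱼ = u k (suc j)
      vⱼ = v k (suc j)
      M-b : M (x ∷ bs) ≡ elementary x · mat ε (- uⱼ) uⱼ vⱼ · elementary x
      M-b = cong (_· elementary x)
        (trans (M-∷ʳ (replicate (suc j) k) x) (cong (elementary x ·_) (M-replicate k (suc j))))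
      b-solution : _≈ₘ_ N (M (x ∷ bs)) Id ⊎ _≈ₘ_ N (M (x ∷ bs)) -Id
      b-solution = scalar-solution (M (x ∷ bs)) ε
        (subst (λ X → _≈ₘ_ N X (mat (- ε) 0ℤ 0ℤ (- ε))) (sym M-b)
          (sandwich ε uⱼ vⱼ (Sign-square sign) (det≡1 k (suc j))))
        sign

    -- Indecomposability of the constant tuple of size s, read off the sequence u.
    Indecomposable : ℤ → ℕ → Set
    Indecomposable k s =
      ¬ (+ N ∣ k) × (∀ j → 2 ≤ j → 2 ℕ.+ j ≤ s → ¬ Sign (u k j))

    -- If N divides k, then (k, k) is already a solution and the tuple is the excluded (0, 0). The
    -- tuple c is only congruent to the constant one because the count ranges over such tuples.
    irreducible⇒indecomposable : ∀ {t} (c : Vec ℤ t) k s → IsMinimalSize N k s →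
      ¬ (1ℤ ≈ 0ℤ [mod N ]) → c ≋ replicate s k → Irreducible N c → Indecomposable k s
    irreducible⇒indecomposable c k s (s-sol , s-min) 1≉0 c≋ (_ , ¬red , ¬00) = k≉0 , no-sign
      where
      k≉0 : ¬ (+ N ∣ k)
      k≉0 N∣k = ¬00 (≋-trans c≋ (size s s-sol (s-min 2 two)))
        where
        k≈0 : k ≈ 0ℤ [mod N ]
        k≈0 = ∣⇒≈0 N∣k
        two : IsSolution N (replicate 2 k)
        two = IsSolution-resp (≈-sym k≈0 ∷ ≈-sym k≈0 ∷ []) (s≤s z≤n , inj₂ (≡⇒≈ₘ { -Id } refl))
        size : ∀ s → IsSolution N (replicate s k) → s ≤ 2 → replicate s k ≋ 0ℤ ∷ 0ℤ ∷ []
        size 0 (() , _) _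
        size 1 sol _ = contradiction
          (≈-trans (≡⇒≈ (one k)) (∣⇒≈0 (solution⇒u≈0 k 1 sol))) 1≉0
          where
          one : ∀ k → 1ℤ ≡ 1ℤ + k * 0ℤ
          one = solve-∀
        size 2 _ _ = k≈0 ∷ k≈0 ∷ []
        size (suc (suc (suc _))) _ (s≤s (s≤s ()))
      no-sign : ∀ j → 2 ≤ j → 2 ℕ.+ j ≤ s → ¬ Sign (u k j)
      no-sign 1 (s≤s ()) _ _
      -- The bound gives s = 4 + r with j ≤ r, so the first summand is left with i = r - j.
      no-sign (suc (suc j)) _ (s≤s (s≤s (s≤s (s≤s {n = r} j≤r)))) sign = ¬red
        (sign⇒reducible c k (r ℕ.∸ j) j
          (subst (λ r → c ≋ replicate (4 ℕ.+ r) k) (sym (ℕ.m∸n+n≡m j≤r)) c≋) sign)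

    indecomposable⇒irreducible : ∀ k s → IsMinimalSize N k s → Indecomposable k s →
      Irreducible N (replicate s k)
    indecomposable⇒irreducible k s (s-sol , _) (k≉0 , no-sign) = s-sol , ¬red , ¬00 s
      where
      ¬red : ¬ Reducible N (replicate s k)
      ¬red red with i , j , refl , sign ← reducible⇒sign k s red =
        no-sign (2 ℕ.+ j) (s≤s (s≤s z≤n)) (ℕ.+-monoʳ-≤ 4 (ℕ.m≤n+m j i)) sign
      ¬00 : ∀ s → ¬ (replicate s k ≋ 0ℤ ∷ 0ℤ ∷ [])
      ¬00 (suc s) (k≈0 ∷ _) = k≉0 (≈0⇒∣ k≈0)

    IsMinimalSize-resp : ∀ {k k′ s} → k ≈ k′ [mod N ] → IsMinimalSize N k s → IsMinimalSize N k′ s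
    IsMinimalSize-resp {k} {k′} {s} k≈k′ (sol , min) =
      IsSolution-resp (all s k≈k′) sol ,
      λ t sol′ → min t (IsSolution-resp (all t (≈-sym k≈k′)) sol′)
      where
      all : ∀ t {k k′} → k ≈ k′ [mod N ] → replicate t k ≋ replicate t k′
      all zero    k≈k′ = []
      all (suc t) k≈k′ = k≈k′ ∷ all t k≈k′

  -- Arithmetic of the sequence u modulo prime powers

  coprime-*ʳ : ∀ {a b c} → Coprime a b → Coprime a c → Coprime a (b ℕ.* c)
  coprime-*ʳ a⊥b a⊥c (d∣a , d∣bc) =
    a⊥c (d∣a , coprime-divisor (λ (e∣d , e∣b) → a⊥b (ℕ.∣-trans e∣d d∣a , e∣b)) d∣bc)

  coprime-^ʳ : ∀ {a b} n → Coprime a b → Coprime a (b ℕ.^ n)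
  coprime-^ʳ zero    a⊥b (_ , d∣1) = ℕ.∣1⇒≡1 d∣1
  coprime-^ʳ (suc n) a⊥b = coprime-*ʳ a⊥b (coprime-^ʳ n a⊥b)

  prime-∤⇒coprime : ∀ {p a} → Prime p → ¬ (p ℕ.∣ a) → Coprime a p
  prime-∤⇒coprime pr p∤a (d∣a , d∣p) with prime⇒irreducible pr d∣p
  ... | inj₁ d≡1  = d≡1
  ... | inj₂ refl = contradiction d∣a p∤a

  even-or-odd : ∀ s → (∃[ r ] s ≡ r ℕ.* 2) ⊎ (∃[ r ] s ≡ suc (r ℕ.* 2))
  even-or-odd zero = inj₁ (0 , refl)
  even-or-odd (suc s) with even-or-odd s
  ... | inj₁ (r , refl) = inj₂ (r , refl)
  ... | inj₂ (r , refl) = inj₁ (suc r , refl)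

  -- Modulo k the recurrence becomes u_{t+2} ≡ -u_t, starting from u_0 = 0.
  k∣u-even : ∀ k r → k ∣ u k (r ℕ.* 2)
  k∣u-even k zero    = divides 0ℤ refl
  k∣u-even k (suc r) =
    ∣m∣n⇒∣m+n (∣m⇒∣-m (k∣u-even k r)) (∣m⇒∣m*n (u k (suc (r ℕ.* 2))) ∣-refl)

  abstract
    -- For odd s = 2 r + 1, d would divide `u k s` and also `u k (r * 2)`, a multiple of k, hence 1
    -- by `det≡1`.
    ∣u⇒even : ∀ {d k} s → ¬ (d ∣ 1ℤ) → d ∣ k → d ∣ u k s → ∃[ r ] s ≡ r ℕ.* 2
    ∣u⇒even {d} {k} s d∤1 d∣k d∣u with even-or-odd s
    ... | inj₁ even       = even
    ... | inj₂ (r , refl) = contradiction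
      (subst (d ∣_) (det≡1 k (r ℕ.* 2))
        (∣m∣n⇒∣m+n (∣n⇒∣m*n (v k (r ℕ.* 2)) d∣u)
                   (∣m⇒∣m*n (u k (r ℕ.* 2)) (∣-trans d∣k (k∣u-even k r))))) d∤1

  -- Lifting the exponent: modulo u k t q², the u-component of (v + u A) ^ i is
  -- i v ^ (i - 1) u. Multiplication by v avoids the exponent i - 1.
  lifting : ∀ k t q → q ∣ k → q ∣ u k t → ∀ i → ∃[ g ]
    u k (i ℕ.* t) ≡ u k t * g ×
    q * q ∣ v k t * g - + i * v k t ^ i ×
    q * q ∣ v k (i ℕ.* t) - v k t ^ i
  lifting k t q q∣k q∣d zero = 0ℤ , sym (ℤ.*-zeroʳ (u k t)) ,
    divides 0ℤ (eq (v k t)) , divides 0ℤ refl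
    where
    eq : ∀ x → x * 0ℤ - 0ℤ * 1ℤ ≡ 0ℤ
    eq = solve-∀
  lifting k t q q∣k q∣d (suc i) with lifting k t q q∣k q∣d i
  ... | g , u≡ , q²∣g , q²∣v =
      x * g + v k (i ℕ.* t) + k * d * g
    , trans (u-+ k t (i ℕ.* t))
        (trans (cong (λ w → x * w + d * v k (i ℕ.* t) + k * (d * w)) u≡)
          (e₁ k x d g (v k (i ℕ.* t))))
    , subst (q * q ∣_) (e₂ k x d g (v k (i ℕ.* t)) (+ i) (x ^ i))
        (∣m∣n⇒∣m+n (∣m∣n⇒∣m+n (∣n⇒∣m*n x q²∣g) (∣n⇒∣m*n x q²∣v))
          (∣n⇒∣m*n (x * g) (*-mono-∣ q∣k q∣d)))
    , subst (q * q ∣_)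
        (trans (e₃ x d g (v k (i ℕ.* t)) (x ^ i))
          (cong (_- x ^ suc i)
            (trans (cong (λ w → x * v k (i ℕ.* t) - d * w) (sym u≡))
              (sym (v-+ k t (i ℕ.* t))))))
        (∣m∣n⇒∣m-n (∣n⇒∣m*n x q²∣v) (∣n⇒∣m*n g (*-mono-∣ q∣d q∣d)))
    where
    x d : ℤ
    x = v k t
    d = u k t
    *-mono-∣ : ∀ {a b} → q ∣ a → q ∣ b → q * q ∣ a * b
    *-mono-∣ {a} q∣a q∣b = ∣-trans (*-monoˡ-∣ q q∣a) (*-monoʳ-∣ a q∣b)
    e₁ : ∀ k x d g w → x * (d * g) + d * w + k * (d * (d * g)) ≡ d * (x * g + w + k * d * g)
    e₁ = solve-∀
    e₂ : ∀ k x d g w i y →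
      x * (x * g - i * y) + x * (w - y) + x * g * (k * d) ≡
      x * (x * g + w + k * d * g) - (1ℤ + i) * (x * y)
    e₂ = solve-∀
    e₃ : ∀ x d g w y → x * (w - y) - g * (d * d) ≡ (x * w - d * (d * g)) - x * y
    e₃ = solve-∀

  -- Abstract, as with-abstraction would otherwise normalise the proofs.
  abstract
    u-even : ∀ k r → ∃[ g ] u k (r ℕ.* 2) ≡ k * g × (∀ d → d ∣ k * k → d ∣ g → d ∣ + r)
    -- Lifting from t = 2 with q = k, where u_2 = k. As v_2 = -1, the powers of v square to 1 and
    -- can be cancelled.
    u-even k r with lifting k 2 k ∣-refl (k∣u-even k 1) r
    ... | g , u≡ , k²∣ , _ = g , trans u≡ (cong (_* g) (u₂ k)) , λ d d∣k² d∣g →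
      subst (d ∣_) (cancel (+ r))
        (∣n⇒∣m*n (x ^ r) (subst (d ∣_) (eq (x * g) (+ r * x ^ r))
          (∣m∣n⇒∣m-n (∣n⇒∣m*n x d∣g) (∣-trans d∣k² k²∣))))
      where
      x : ℤ
      x = v k 2
      u₂ : ∀ k → - 0ℤ + k * (1ℤ + k * 0ℤ) ≡ k
      u₂ = solve-∀
      eq : ∀ a b → a - (a - b) ≡ b
      eq = solve-∀
      x² : ∀ i → x ^ i * x ^ i ≡ 1ℤ
      x² zero    = refl
      x² (suc i) = trans (e k (x ^ i)) (x² i)
        where
        e : ∀ k y → - (1ℤ + k * 0ℤ) * y * (- (1ℤ + k * 0ℤ) * y) ≡ y * y
        e = solve-∀
      cancel : ∀ i → x ^ r * (i * x ^ r) ≡ i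
      cancel i = trans (e (x ^ r) i) (trans (cong (_* i) (x² r)) (ℤ.*-identityˡ i))
        where
        e : ∀ y i → y * (i * y) ≡ y * y * i
        e = solve-∀

  -- Minimality, doubling formulas and neighbouring terms.

  no-smaller : ∀ {N k s} → IsMinimalSize N k s → ∀ t → 1 ≤ t → t < s →
    + N ∣ u k t → ¬ Sign N (v k t)
  no-smaller {N} {k} (_ , min) t 1≤t t<s N∣u sign =
    ℕ.<⇒≱ t<s (min t (u≈0⇒solution N k t 1≤t N∣u sign))

  Sign-v : ∀ {N k} t → + N ∣ u k t → Sign N (u k (suc t)) → Sign N (v k t)
  Sign-v {N} {k} t N∣u = Sign-resp N (congruent (∣-linear₁ k N∣u (eq k (u k t) (v k t))))
    where
    eq : ∀ k u v → v + k * u - v ≡ k * u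
    eq = solve-∀

  -- The cofactor 2 v + k u is the trace of the t-th power of `elementary k`. Traces are also the
  -- cofactors in the next two factorisations, where 1 is first rewritten by `det≡1`.
  double : ∀ k t → u k (t ℕ.+ t) ≡ u k t * (+ 2 * v k t + k * u k t)
  double k t = trans (u-+ k t t) (eq k (u k t) (v k t))
    where
    eq : ∀ k u v → v * u + u * v + k * (u * u) ≡ u * (+ 2 * v + k * u)
    eq = solve-∀

  double+1 : ∀ k t → u k (suc (t ℕ.+ t)) - 1ℤ ≡
    u k t * (+ 2 * v k (suc t) + k * u k (suc t))
  double+1 k t = trans (cong₂ (λ a b → a + k * b - 1ℤ) (v-+ k t t) (u-+ k t t))
    (trans (cong (λ c → v′ * v′ - u′ * u′ + k * (v′ * u′ + u′ * v′ + k * (u′ * u′)) - c)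
             (sym (det≡1 k t)))
      (eq k u′ v′))
    where
    u′ v′ : ℤ
    u′ = u k t
    v′ = v k t
    eq : ∀ k u v →
      v * v - u * u + k * (v * u + u * v + k * (u * u)) - (v * (v + k * u) + u * u) ≡
      u * (+ 2 * - u + k * (v + k * u))
    eq = solve-∀

  double-1 : ∀ k t → u k (suc (t ℕ.+ t)) + 1ℤ ≡
    u k (suc t) * (+ 2 * v k t + k * u k t)
  double-1 k t = trans (cong₂ (λ a b → a + k * b + 1ℤ) (v-+ k t t) (u-+ k t t))
    (trans (cong (λ c → v′ * v′ - u′ * u′ + k * (v′ * u′ + u′ * v′ + k * (u′ * u′)) + c)
             (sym (det≡1 k t)))
      (eq k u′ v′))
    where
    u′ v′ : ℤ
    u′ = u k t
    v′ = v k t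
    eq : ∀ k u v →
      v * v - u * u + k * (v * u + u * v + k * (u * u)) + (v * (v + k * u) + u * u) ≡
      (v + k * u) * (+ 2 * v + k * u)
    eq = solve-∀

  -- Since `v k (suc i)` is `- u k i`, `det≡1` at `suc i` is the Cassini identity u_{i+1}² - u_i
  -- u_{i+2} = 1.
  neighbours : ∀ {N k} i → Sign N (u k (suc i)) → + N ∣ u k i * u k (2 ℕ.+ i)
  neighbours {N} {k} i sign = subst (+ N ∣_)
    (trans (cong (λ c → w * w - c) (sym (det≡1 k (suc i)))) (eq (u k i) (u k (2 ℕ.+ i)) w))
    (modulus∣difference (Sign-square N sign))
    where
    w : ℤ
    w = u k (suc i)
    eq : ∀ a b w → w * w - (- a * b + w * w) ≡ a * b
    eq = solve-∀

  -- Divisibility by a prime and its powers.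

  module _ {p : ℕ} (p-prime : Prime p) where

    private instance
      p≢0 : NonZero p
      p≢0 = prime⇒nonZero p-prime

    p∤1 : ¬ (+ p ∣ 1ℤ)
    p∤1 p∣1 = contradiction (ℕ.∣1⇒≡1 (∣⇒∣ᵤ p∣1)) (ℕ.nonTrivial⇒≢1 {{prime⇒nonTrivial p-prime}})

    euclid : ∀ a b → + p ∣ a * b → + p ∣ a ⊎ + p ∣ b
    euclid a b p∣ab = Sum.map ∣ᵤ⇒∣ ∣ᵤ⇒∣
      (euclidsLemma ℤ.∣ a ∣ ℤ.∣ b ∣ p-prime (subst (p ℕ.∣_) (ℤ.abs-* a b) (∣⇒∣ᵤ p∣ab)))

    p∤^ : ∀ {a} → ¬ (+ p ∣ a) → ∀ i → ¬ (+ p ∣ a ^ i)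
    p∤^ p∤a zero    = p∤1
    p∤^ {a} p∤a (suc i) p∣ = [ p∤a , p∤^ p∤a i ]′ (euclid a (a ^ i) p∣)

    cancel-unit : ∀ n a b → ¬ (+ p ∣ b) → + (p ℕ.^ n) ∣ a * b → + (p ℕ.^ n) ∣ a
    cancel-unit n a b p∤b ∣ab = ∣ᵤ⇒∣ (coprime-divisor coprime
      (subst (p ℕ.^ n ℕ.∣_) (trans (ℤ.abs-* a b) (ℕ.*-comm ℤ.∣ a ∣ ℤ.∣ b ∣)) (∣⇒∣ᵤ ∣ab)))
      where
      coprime : Coprime (p ℕ.^ n) ℤ.∣ b ∣
      coprime (d∣pⁿ , d∣b) = coprime-^ʳ n (prime-∤⇒coprime p-prime (λ p∣b → p∤b (∣ᵤ⇒∣ p∣b)))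
        (d∣b , d∣pⁿ)

    p∣p^ : ∀ n → + p ∣ + (p ℕ.^ suc n)
    p∣p^ n = ∣ᵤ⇒∣ (ℕ.m∣m*n (p ℕ.^ n))

    -- The case where p does not divide k.

    module _ (n : ℕ) {k : ℤ} {s : ℕ} (minimal : IsMinimalSize (p ℕ.^ suc n) k s) where

      private
        N : ℕ
        N = p ℕ.^ suc n

      ∤⇒indecomposable : ¬ (+ p ∣ k) → Indecomposable N k s
      ∤⇒indecomposable p∤k = (λ N∣k → p∤k (∣-trans (p∣p^ n) N∣k)) , no-sign
        where
        no-sign : ∀ j → 2 ≤ j → 2 ℕ.+ j ≤ s → ¬ Sign N (u k j)
        no-sign 1 (s≤s ()) _ _
        no-sign (suc (suc i)) _ 4+i≤s sign with + p ∣? u k (suc i) | + p ∣? u k (3 ℕ.+ i)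
        -- Put j = 2 + i. If p does not divide u_{j-1}, then N divides u_{j+1}, and v_{j+1} = -u_j
        -- is again ±1. The bound 2 + j ≤ s makes the size j + 1 smaller than s.
        ... | no p∤ | _ = no-smaller minimal (3 ℕ.+ i) (s≤s z≤n) 4+i≤s
              (cancel-unit (suc n) (u k (3 ℕ.+ i)) (u k (suc i)) p∤
                (subst (+ N ∣_) (ℤ.*-comm (u k (suc i)) (u k (3 ℕ.+ i)))
                  (neighbours {N} (suc i) sign)))
              (Sign-neg N sign)
        ... | yes _ | no p∤ = no-smaller minimal (suc i) (s≤s z≤n)
              (ℕ.≤-trans (ℕ.m≤n+m (2 ℕ.+ i) 2) 4+i≤s) N∣u (Sign-v (suc i) N∣u sign)
          where
          N∣u : + N ∣ u k (suc i)
          N∣u = cancel-unit (suc n) (u k (suc i)) (u k (3 ℕ.+ i)) p∤ (neighbours {N} (suc i) sign)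
        -- If p divides both neighbours of u_j, it divides their sum k u_j; but two consecutive
        -- terms are never both divisible by p, by `det≡1`.
        ... | yes p∣u | yes p∣u″ = [ p∤k , p∤u′ ]′ (euclid k u′ p∣ku′)
          where
          u′ : ℤ
          u′ = u k (2 ℕ.+ i)
          p∣ku′ : + p ∣ k * u′
          p∣ku′ = ∣m+n∣m⇒∣n {m = - u k (suc i)} p∣u″ (∣m⇒∣-m p∣u)
          p∤u′ : ¬ (+ p ∣ u′)
          p∤u′ p∣u′ = p∤1 (subst (+ p ∣_) (det≡1 k (suc i))
            (∣m∣n⇒∣m+n (∣n⇒∣m*n (v k (suc i)) p∣u′) (∣m⇒∣m*n (u k (suc i)) p∣u)))

    -- The case where p divides k, with its conclusion for odd p.

    -- An odd p cannot divide both x - 1 and x + 1, whose difference is 2, so the whole prime power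
    -- divides one of them.
    Sign-√ : p ≢ 2 → ∀ n x → + (p ℕ.^ n) ∣ x * x - 1ℤ → Sign (p ℕ.^ n) x
    Sign-√ p≢2 n x x² with + p ∣? x - 1ℤ | + p ∣? x - - 1ℤ
    ... | no p∤ | _     = inj₂ (congruent (cancel-unit n (x - - 1ℤ) (x - 1ℤ) p∤
      (subst (+ (p ℕ.^ n) ∣_) (eq x) x²)))
      where
      eq : ∀ x → x * x - 1ℤ ≡ (x - - 1ℤ) * (x - 1ℤ)
      eq = solve-∀
    ... | yes _ | no p∤ = inj₁ (congruent (cancel-unit n (x - 1ℤ) (x - - 1ℤ) p∤
      (subst (+ (p ℕ.^ n) ∣_) (eq x) x²)))
      where
      eq : ∀ x → x * x - 1ℤ ≡ (x - 1ℤ) * (x - - 1ℤ)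
      eq = solve-∀
    ... | yes p∣x-1 | yes p∣x+1 = contradiction p∣2 p∤2
      where
      eq : ∀ x → (x - - 1ℤ) - (x - 1ℤ) ≡ + 2
      eq = solve-∀
      p∣2 : p ℕ.∣ 2
      p∣2 = ∣⇒∣ᵤ (subst (+ p ∣_) (eq x) (∣m∣n⇒∣m-n p∣x+1 p∣x-1))
      p∤2 : ¬ (p ℕ.∣ 2)
      p∤2 p∣2 with irreducible[2] p∣2
      ... | inj₁ refl = ¬prime[1] p-prime
      ... | inj₂ p≡2  = p≢2 p≡2

    p∣u⇒p∤v : ∀ {k} t → + p ∣ u k t → ¬ (+ p ∣ v k t)
    p∣u⇒p∤v {k} t p∣u p∣v = p∤1 (subst (+ p ∣_) (det≡1 k t)
      (∣m∣n⇒∣m+n (∣m⇒∣m*n (u k (suc t)) p∣v) (∣m⇒∣m*n (u k t) p∣u)))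

    p^∣-* : ∀ n {a b} → + p ∣ a → + (p ℕ.^ n) ∣ b → + (p ℕ.^ suc n) ∣ a * b
    p^∣-* n {a} {b} p∣a P∣b = subst (_∣ a * b) (sym (ℤ.pos-* p (p ℕ.^ n)))
      (∣-trans (*-monoˡ-∣ (+ (p ℕ.^ n)) p∣a) (*-monoʳ-∣ a P∣b))

    p^∣-cancel : ∀ n {a} → + (p ℕ.^ suc n) ∣ + p * a → + (p ℕ.^ n) ∣ a
    p^∣-cancel n {a} N∣ = *-cancelˡ-∣ (+ p) (subst (_∣ + p * a) (ℤ.pos-* p (p ℕ.^ n)) N∣)

    -- By `lifting` at i = p, v u_{pt} = p u_t (v^p + p e) with v = `v k t`. The last factor is
    -- prime to p, so exactly one factor p is lost.
    lowering : ∀ n k t → + p ∣ k → + p ∣ u k t →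
      + (p ℕ.^ suc n) ∣ u k (p ℕ.* t) → + (p ℕ.^ n) ∣ u k t
    lowering n k t p∣k p∣d N∣u with lifting k t (+ p) p∣k p∣d p
    ... | h , u≡ , divides e eq , _ =
      cancel-unit n d (y + + p * e)
        (λ p∣ → p∤^ (p∣u⇒p∤v t p∣d) p (∣m+n∣n⇒∣m p∣ (∣m⇒∣m*n e ∣-refl)))
        (p^∣-cancel n (subst (+ (p ℕ.^ suc n) ∣_) expand
          (∣n⇒∣m*n x (subst (+ (p ℕ.^ suc n) ∣_) u≡ N∣u))))
      where
      d x y : ℤ
      d = u k t
      x = v k t
      y = x ^ p
      e₁ : ∀ x d h z → x * (d * h) ≡ d * (x * h - z + z)
      e₁ = solve-∀
      e₂ : ∀ d e y q → d * (e * (q * q) + q * y) ≡ q * (d * (y + q * e))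
      e₂ = solve-∀
      expand : x * (d * h) ≡ + p * (d * (y + + p * e))
      expand = trans (e₁ x d h (+ p * y))
        (trans (cong (λ c → d * (c + + p * y)) eq) (e₂ d e y (+ p)))

    -- By `det≡1` the left side is u_{t+1} k u_t - u_t². Each term gains one more factor p, the
    -- first from k and the second from u_t.
    u-suc-square : ∀ n k t → + p ∣ k → + p ∣ u k t → + (p ℕ.^ n) ∣ u k t →
      + (p ℕ.^ suc n) ∣ u k (suc t) * u k (suc t) - 1ℤ
    u-suc-square n k t p∣k p∣d P∣d =
      ∣-linear₂ (u k (suc t)) (- 1ℤ) (p^∣-* n p∣k P∣d) (p^∣-* n p∣d P∣d)
        (trans (cong (λ c → u k (suc t) * u k (suc t) - c) (sym (det≡1 k t)))
          (eq k (u k t) (v k t)))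
      where
      eq : ∀ k d x → (x + k * d) * (x + k * d) - (x * (x + k * d) + d * d) ≡
        (x + k * d) * (k * d) + - 1ℤ * (d * d)
      eq = solve-∀

    -- With s = 2 r, u k s = k g for some g ≡ ± r modulo p.
    ∣u⇒multiple : ∀ n k s → + p ∣ k → ¬ (+ (p ℕ.^ suc n) ∣ k) →
      + (p ℕ.^ suc n) ∣ u k s → ∃[ m ] s ≡ p ℕ.* (m ℕ.* 2)
    ∣u⇒multiple n k s p∣k N∤k N∣u
      with r , s≡ ← ∣u⇒even s p∤1 p∣k (∣-trans (p∣p^ n) N∣u)
      with g , u≡kg , r-div ← u-even k r
      with + p ∣? g
    ... | no p∤g = contradiction (cancel-unit (suc n) k g p∤g
            (subst (+ (p ℕ.^ suc n) ∣_) (trans (cong (u k) s≡) u≡kg) N∣u)) N∤k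
    ... | yes p∣g with ∣⇒∣ᵤ (r-div (+ p) (∣m⇒∣m*n k p∣k) p∣g)
    ... | ℕ.divides m r≡ = m , trans s≡ (trans (cong (ℕ._* 2) r≡) (swap m p))
      where
      swap : ∀ m p → m ℕ.* p ℕ.* 2 ≡ p ℕ.* (m ℕ.* 2)
      swap = solveℕ-∀

    -- At t = s / p, `lowering` loses one factor p and `u-suc-square` regains it, so u_{t+1} squares
    -- to 1 modulo the full prime power.
    odd-∣⇒sign : p ≢ 2 → ∀ n {k s} → IsMinimalSize (p ℕ.^ suc n) k s →
      + p ∣ k → ¬ (+ (p ℕ.^ suc n) ∣ k) →
      ∃[ j ] 2 ≤ j × 2 ℕ.+ j ≤ s × Sign (p ℕ.^ suc n) (u k j)
    odd-∣⇒sign p≢2 n {k} {s} minimal p∣k N∤k =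
        suc t , s≤s (1≤t m s≡) , subst (3 ℕ.+ t ≤_) (sym s≡) (bound m s≡)
      , Sign-√ p≢2 (suc n) (u k (suc t)) (u-suc-square n k t p∣k p∣d
          (lowering n k t p∣k p∣d (subst (λ i → + (p ℕ.^ suc n) ∣ u k i) s≡ N∣u)))
      where
      N∣u : + (p ℕ.^ suc n) ∣ u k s
      N∣u = solution⇒u≈0 (p ℕ.^ suc n) k s (proj₁ minimal)
      multiple : ∃[ m ] s ≡ p ℕ.* (m ℕ.* 2)
      multiple = ∣u⇒multiple n k s p∣k N∤k N∣u
      m t : ℕ
      m = proj₁ multiple
      t = m ℕ.* 2
      s≡ : s ≡ p ℕ.* t
      s≡ = proj₂ multiple
      p∣d : + p ∣ u k t
      p∣d = ∣-trans p∣k (k∣u-even k m)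
      3≤p : 3 ≤ p
      3≤p = ℕ.≤∧≢⇒< (ℕ.nonTrivial⇒n>1 p {{prime⇒nonTrivial p-prime}}) (λ 2≡p → p≢2 (sym 2≡p))
      1≤t : ∀ m → s ≡ p ℕ.* (m ℕ.* 2) → 1 ≤ m ℕ.* 2
      1≤t zero    s≡ = contradiction (proj₁ (proj₁ minimal))
        (subst (λ s → ¬ (1 ≤ s)) (sym (trans s≡ (ℕ.*-zeroʳ p))) λ ())
      1≤t (suc m) _  = s≤s z≤n
      -- As t is even and positive, t ≥ 2, whence 3 + t ≤ 3 t ≤ p t.
      bound : ∀ m → s ≡ p ℕ.* (m ℕ.* 2) → 3 ℕ.+ m ℕ.* 2 ≤ p ℕ.* (m ℕ.* 2)
      bound zero    s≡ = contradiction (1≤t zero s≡) λ ()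
      bound (suc m) _  = begin
        3 ℕ.+ suc m ℕ.* 2                    ≤⟨ ℕ.m≤m+n _ (1 ℕ.+ m ℕ.* 4) ⟩
        3 ℕ.+ suc m ℕ.* 2 ℕ.+ (1 ℕ.+ m ℕ.* 4) ≡⟨ eq m ⟩
        3 ℕ.* (suc m ℕ.* 2)                  ≤⟨ ℕ.*-monoˡ-≤ (suc m ℕ.* 2) 3≤p ⟩
        p ℕ.* (suc m ℕ.* 2)                  ∎
        where
        open ℕ.≤-Reasoning
        eq : ∀ m → 3 ℕ.+ suc m ℕ.* 2 ℕ.+ (1 ℕ.+ m ℕ.* 4) ≡ 3 ℕ.* (suc m ℕ.* 2)
        eq = solveℕ-∀

    Sign-∤ : ∀ n {x} → Sign (p ℕ.^ suc n) x → ¬ (+ p ∣ x)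
    Sign-∤ n {x} (inj₁ (congruent q)) p∣x =
      p∤1 (subst (+ p ∣_) (eq x) (∣m∣n⇒∣m-n p∣x (∣-trans (p∣p^ n) q)))
      where
      eq : ∀ x → x - (x - 1ℤ) ≡ 1ℤ
      eq = solve-∀
    Sign-∤ n {x} (inj₂ (congruent q)) p∣x =
      p∤1 (subst (+ p ∣_) (eq x) (∣m∣n⇒∣m-n (∣-trans (p∣p^ n) q) p∣x))
      where
      eq : ∀ x → (x - - 1ℤ) - x ≡ 1ℤ
      eq = solve-∀

  -- Powers of two: the modulus N and its half Q.

  odd⇒2∣pred : ∀ {a} → Odd a → + 2 ∣ a - 1ℤ
  odd⇒2∣pred {a} odd with a %ℕ 2 | n%ℕd<d a 2 | a≡a%ℕn+[a/ℕn]*n a 2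
  ... | 0 | _ | eq = contradiction (divides (a /ℕ 2) (trans eq (ℤ.+-identityˡ _))) odd
  ... | 1 | _ | eq = divides (a /ℕ 2) (trans (cong (_- 1ℤ) eq) (cancel (a /ℕ 2)))
    where
    cancel : ∀ q → 1ℤ + q * + 2 - 1ℤ ≡ q * + 2
    cancel = solve-∀
  ... | suc (suc _) | s≤s (s≤s ()) | _

  2∣2 : + 2 ∣ + 2
  2∣2 = ∣-refl

  module _ (n : ℕ) {k : ℤ} {s : ℕ} (minimal : IsMinimalSize (2 ℕ.^ (2 ℕ.+ n)) k s) where

    private
      N Q : ℕ
      N = 2 ℕ.^ (2 ℕ.+ n)
      Q = 2 ℕ.^ (1 ℕ.+ n)

      Q∣N : + Q ∣ + N
      Q∣N = ∣ᵤ⇒∣ (ℕ.n∣m*n 2)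

    -- If g contained at most one factor 2, then k would have to supply all of Q.
    4∣cofactor : ¬ (+ Q ∣ k) → ∀ g → + N ∣ k * g → + 4 ∣ g
    4∣cofactor Q∤k g N∣kg with + 2 ∣? g
    ... | no 2∤g = contradiction
      (∣-trans Q∣N (cancel-unit prime[2] (2 ℕ.+ n) k g 2∤g N∣kg)) Q∤k
    ... | yes (divides h g≡) with + 2 ∣? h
    ... | no 2∤h = contradiction
      (cancel-unit prime[2] (1 ℕ.+ n) k h 2∤h (p^∣-cancel prime[2] (1 ℕ.+ n)
        (subst (+ N ∣_) (trans (cong (k *_) g≡) (eq k h)) N∣kg))) Q∤k
      where
      eq : ∀ k h → k * (h * + 2) ≡ + 2 * (k * h)
      eq = solve-∀
    ... | yes (divides i h≡) =
      divides i (trans g≡ (trans (cong (_* + 2) h≡) (ℤ.*-assoc i (+ 2) (+ 2))))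

    -- Write s = 2 r and u_s = k g. Then 4 divides g by `4∣cofactor`, and it divides k², so `u-even`
    -- passes the divisibility on to r.
    ∣u⇒8∣ : + 4 ∣ k → ¬ (+ Q ∣ k) → + N ∣ u k s → ∃[ m ] s ≡ 2 ℕ.* (2 ℕ.* (m ℕ.* 2))
    ∣u⇒8∣ 4∣k Q∤k N∣u
      with r , s≡ ← ∣u⇒even {+ 2} {k} s (p∤1 prime[2]) (∣-trans (divides (+ 2) refl) 4∣k)
                      (∣-trans (p∣p^ prime[2] (1 ℕ.+ n)) N∣u)
      with g , u≡kg , r-div ← u-even k r
      with ℕ.divides m r≡ ← ∣⇒∣ᵤ (r-div (+ 4) (∣m⇒∣m*n k 4∣k) (4∣cofactor Q∤k g
             (subst (+ N ∣_) (trans (cong (u k) s≡) u≡kg) N∣u)))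
      = m , trans s≡ (trans (cong (ℕ._* 2) r≡) (eq m))
      where
      eq : ∀ m → m ℕ.* 4 ℕ.* 2 ≡ 2 ℕ.* (2 ℕ.* (m ℕ.* 2))
      eq = solveℕ-∀

    -- For t = s / 4, the factors of u k (1 + 2 t) - 1 = u k t (2 v k (1 + t) + k u k (1 + t))
    -- are divisible by 2 ^ n and by 4.
    4∣⇒sign : + 4 ∣ k → ¬ (+ Q ∣ k) → ∃[ j ] 2 ≤ j × 2 ℕ.+ j ≤ s × Sign N (u k j)
    4∣⇒sign 4∣k Q∤k =
      suc (t ℕ.+ t) , proj₁ (bounds m s≡) , proj₂ (bounds m s≡) , inj₁ (congruent N∣)
      where
      multiple : ∃[ m ] s ≡ 2 ℕ.* (2 ℕ.* (m ℕ.* 2))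
      multiple = ∣u⇒8∣ 4∣k Q∤k (solution⇒u≈0 N k s (proj₁ minimal))
      m t : ℕ
      m = proj₁ multiple
      t = m ℕ.* 2
      s≡ : s ≡ 2 ℕ.* (2 ℕ.* t)
      s≡ = proj₂ multiple
      2∣k : + 2 ∣ k
      2∣k = ∣-trans (divides (+ 2) refl) 4∣k
      2∣uₜ : + 2 ∣ u k t
      2∣uₜ = ∣-trans 2∣k (k∣u-even k m)
      2∣u₂ₜ : + 2 ∣ u k (2 ℕ.* t)
      2∣u₂ₜ = ∣-trans 2∣k (subst (λ i → k ∣ u k i) (ℕ.*-comm t 2) (k∣u-even k t))
      2ⁿ∣uₜ : + (2 ℕ.^ n) ∣ u k t
      -- Two lowerings, from s to s / 2 and then to s / 4, each at the cost of one factor 2.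
      2ⁿ∣uₜ = lowering prime[2] n k t 2∣k 2∣uₜ
        (lowering prime[2] (1 ℕ.+ n) k (2 ℕ.* t) 2∣k 2∣u₂ₜ
          (subst (λ i → + N ∣ u k i) s≡ (solution⇒u≈0 N k s (proj₁ minimal))))
      4∣L : + 4 ∣ + 2 * v k (suc t) + k * u k (suc t)
      -- `v k (suc t)` is `- u k t`, which is even.
      4∣L = ∣m∣n⇒∣m+n (*-monoʳ-∣ (+ 2) (∣m⇒∣-m 2∣uₜ)) (∣m⇒∣m*n (u k (suc t)) 4∣k)
      N∣ : + N ∣ u k (suc (t ℕ.+ t)) - 1ℤ
      N∣ = ∣-linear₁ (quotient 4∣L)
        (p^∣-* prime[2] (1 ℕ.+ n) 2∣2 (p^∣-* prime[2] n 2∣2 2ⁿ∣uₜ))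
        (trans (double+1 k t)
          (trans (cong (u k t *_) (_∣_.equality 4∣L)) (eq (u k t) (quotient 4∣L))))
        where
        eq : ∀ u q → u * (q * + 4) ≡ q * (+ 2 * (+ 2 * u))
        eq = solve-∀
      bounds : ∀ m → s ≡ 2 ℕ.* (2 ℕ.* (m ℕ.* 2)) →
        2 ≤ suc (m ℕ.* 2 ℕ.+ m ℕ.* 2) × 3 ℕ.+ (m ℕ.* 2 ℕ.+ m ℕ.* 2) ≤ s
      bounds zero    s≡ = contradiction (proj₁ (proj₁ minimal))
        (subst (λ s → ¬ (1 ≤ s)) (sym s≡) λ ())
      bounds (suc m) s≡ = s≤s (s≤s z≤n) ,
        subst (_ ≤_) (trans (eq m) (sym s≡)) (ℕ.m≤m+n _ (1 ℕ.+ m ℕ.* 4))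
        where
        eq : ∀ m → 3 ℕ.+ (suc m ℕ.* 2 ℕ.+ suc m ℕ.* 2) ℕ.+ (1 ℕ.+ m ℕ.* 4) ≡
          2 ℕ.* (2 ℕ.* (suc m ℕ.* 2))
        eq = solveℕ-∀

    -- The traces 2 v k t + k u k t are twice odd numbers.
    2odd⇒indecomposable : ∀ a → Odd a → k ≡ + 2 * a → Indecomposable N k s
    2odd⇒indecomposable a odd k≡ = N∤k , no-sign
      where
      N∤k : ¬ (+ N ∣ k)
      N∤k N∣k = odd (∣-trans (p∣p^ prime[2] n)
        (p^∣-cancel prime[2] (1 ℕ.+ n) (subst (+ N ∣_) k≡ N∣k)))
      o : ℕ → ℤ
      o t = v k t + a * u k t
      o-odd : ∀ t → ¬ (+ 2 ∣ o t)
      o-odd zero 2∣o = p∤1 prime[2] (subst (+ 2 ∣_) (eq a) 2∣o)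
        where
        eq : ∀ a → 1ℤ + a * 0ℤ ≡ 1ℤ
        eq = solve-∀
      -- Here o_{t+1} = a o_t + (a² - 1) u_t, and a² - 1 is even for odd a.
      o-odd (suc t) 2∣o = [ odd , o-odd t ]′ (euclid prime[2] a (o t)
        (subst (+ 2 ∣_)
          (trans (cong (λ c → - u k t + a * (v k t + c * u k t) - (a + 1ℤ) * u k t * (a - 1ℤ)) k≡)
            (eq a (u k t) (v k t)))
          (∣m∣n⇒∣m-n 2∣o (∣n⇒∣m*n ((a + 1ℤ) * u k t) (odd⇒2∣pred odd)))))
        where
        eq : ∀ a u v →
          - u + a * (v + + 2 * a * u) - (a + 1ℤ) * u * (a - 1ℤ) ≡ a * (v + a * u)
        eq = solve-∀
      trace : ∀ t → + 2 * v k t + k * u k t ≡ + 2 * o t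
      trace t = trans (cong (λ c → + 2 * v k t + c * u k t) k≡) (eq a (u k t) (v k t))
        where
        eq : ∀ a u v → + 2 * v + + 2 * a * u ≡ + 2 * (v + a * u)
        eq = solve-∀
      -- All traces are twice odd numbers, so the trace at t′ may be exchanged for the one at t,
      -- which turns the product into u_{2t} by `double`.
      factor : ∀ t t′ → + N ∣ u k t * (+ 2 * v k t′ + k * u k t′) → + N ∣ u k (t ℕ.+ t)
      factor t t′ N∣ = subst (+ N ∣_)
        (trans (eq (u k t) (o t)) (sym (trans (double k t) (cong (u k t *_) (trace t)))))
        (∣n⇒∣m*n (o t) (p^∣-* prime[2] (1 ℕ.+ n) 2∣2
          (cancel-unit prime[2] (1 ℕ.+ n) (u k t) (o t′) (o-odd t′)
            (p^∣-cancel prime[2] (1 ℕ.+ n)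
              (subst (+ N ∣_) (trans (cong (u k t *_) (trace t′)) (eq′ (u k t) (o t′))) N∣)))))
        where
        eq : ∀ u o → o * (+ 2 * u) ≡ u * (+ 2 * o)
        eq = solve-∀
        eq′ : ∀ u o → u * (+ 2 * o) ≡ + 2 * (u * o)
        eq′ = solve-∀
      no-odd : ∀ i → 1 ≤ i → 3 ℕ.+ (i ℕ.+ i) ≤ s → ¬ Sign N (u k (suc (i ℕ.+ i)))
      no-odd i 1≤i ≤s sign@(inj₁ (congruent N∣)) =
        no-smaller minimal (i ℕ.+ i) (ℕ.≤-trans 1≤i (ℕ.m≤m+n i i))
          (ℕ.≤-trans (ℕ.m≤n+m _ 2) ≤s) N∣u (Sign-v (i ℕ.+ i) N∣u sign)
        where
        N∣u : + N ∣ u k (i ℕ.+ i)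
        N∣u = factor i (suc i) (subst (+ N ∣_) (double+1 k i) N∣)
      -- For the sign -1 the factor is u_{i+1}, and the smaller solution has size 2 i + 2, one more
      -- than the index.
      no-odd i _ ≤s sign@(inj₂ (congruent N∣)) =
        no-smaller minimal (suc (suc (i ℕ.+ i))) (s≤s z≤n) ≤s
          (subst (λ j → + N ∣ u k (suc j)) (ℕ.+-suc i i)
            (factor (suc i) i (subst (+ N ∣_) (double-1 k i) N∣)))
          (Sign-neg N sign)
      no-sign : ∀ j → 2 ≤ j → 2 ℕ.+ j ≤ s → ¬ Sign N (u k j)
      no-sign j 2≤j 2+j≤s sign with even-or-odd j
      -- At an even index u_j is a multiple of the even number k, hence not ±1.
      ... | inj₁ (i , refl) = Sign-∤ prime[2] (1 ℕ.+ n) sign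
            (∣-trans (∣-linear₁ a 2∣2 (trans k≡ (ℤ.*-comm (+ 2) a))) (k∣u-even k i))
      no-sign j (s≤s 1≤) 2+j≤s sign | inj₂ (suc i , refl) =
            no-odd (suc i) (s≤s z≤n)
              (subst (λ j → 3 ℕ.+ j ≤ s) (eq i) 2+j≤s)
              (subst (λ j → Sign N (u k (suc j))) (eq i) sign)
        where
        eq : ∀ i → suc i ℕ.* 2 ≡ suc i ℕ.+ suc i
        eq = solveℕ-∀

    -- Both k² and 2 k vanish modulo N, so u_4 = k³ - 2 k ≡ 0 and v_4 = 1 - k² ≡ 1, whence s ≤ 4.
    -- Only j = 2 is left, and u_2 = k is even.
    half⇒indecomposable : k ≈ + Q [mod N ] → Indecomposable N k s
    half⇒indecomposable (congruent N∣k-Q) = N∤k , no-sign s≤4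
      where
      cancel : ∀ k q → k - (k - q) ≡ q
      cancel = solve-∀
      N∤k : ¬ (+ N ∣ k)
      N∤k N∣k = ℕ.>⇒∤ {{ℕ.m^n≢0 2 (1 ℕ.+ n)}}
        (ℕ.^-monoʳ-< 2 (s≤s (s≤s z≤n)) (ℕ.n<1+n (1 ℕ.+ n)))
        (∣⇒∣ᵤ (subst (+ N ∣_) (cancel k (+ Q)) (∣m∣n⇒∣m-n N∣k N∣k-Q)))
      Q∣k : + Q ∣ k
      Q∣k = ∣m+n∣n⇒∣m {m = k} {n = - (+ Q)} (∣-trans Q∣N N∣k-Q) (∣m⇒∣-m ∣-refl)
      2∣k : + 2 ∣ k
      2∣k = ∣-trans (p∣p^ prime[2] n) Q∣k
      N∣k² : + N ∣ k * k
      N∣k² = p^∣-* prime[2] (1 ℕ.+ n) 2∣k Q∣k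
      N∣2k : + N ∣ + 2 * k
      N∣2k = p^∣-* prime[2] (1 ℕ.+ n) 2∣2 Q∣k
      N∣u₄ : + N ∣ u k 4
      N∣u₄ = ∣-linear₂ k (- 1ℤ) N∣k² N∣2k (eq k)
        where
        eq : ∀ k → let u₂ = - 0ℤ + k * (1ℤ + k * 0ℤ) in
          - u₂ + k * (- (1ℤ + k * 0ℤ) + k * u₂) ≡ k * (k * k) + - 1ℤ * (+ 2 * k)
        eq = solve-∀
      v₄≈1 : v k 4 ≈ 1ℤ [mod N ]
      v₄≈1 = congruent (∣-linear₁ (- 1ℤ) N∣k² (eq k))
        where
        eq : ∀ k → - (- (1ℤ + k * 0ℤ) + k * (- 0ℤ + k * (1ℤ + k * 0ℤ))) - 1ℤ ≡ - 1ℤ * (k * k)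
        eq = solve-∀
      s≤4 : s ≤ 4
      s≤4 = proj₂ minimal 4 (u≈0⇒solution N k 4 (s≤s z≤n) N∣u₄ (inj₁ v₄≈1))
      no-sign : s ≤ 4 → ∀ j → 2 ≤ j → 2 ℕ.+ j ≤ s → ¬ Sign N (u k j)
      no-sign s≤4 j 2≤j 2+j≤s sign
        with ℕ.≤-antisym 2≤j (ℕ.+-cancelˡ-≤ 2 j 2 (ℕ.≤-trans 2+j≤s s≤4))
      ... | refl = Sign-∤ prime[2] (1 ℕ.+ n) sign (∣-trans 2∣k (k∣u-even k 1))

  -- Criteria and counting

  lookup-injective : ∀ {A : Set} {xs : List A} → Unique xs → ∀ i j →
    lookup xs i ≡ lookup xs j → i ≡ j
  lookup-injective (_ ∷ _)  zero    zero    _  = refl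
  lookup-injective (p ∷ _)  zero    (suc j) eq = contradiction eq (ListAll.lookup p (∈-lookup j))
  lookup-injective (p ∷ _)  (suc i) zero    eq = contradiction (sym eq) (ListAll.lookup p (∈-lookup i))
  lookup-injective (_ ∷ ps) (suc i) (suc j) eq = cong suc (lookup-injective ps i j eq)

  applyUpTo-+ : ∀ {A : Set} (f : ℕ → A) m n →
    applyUpTo f (m ℕ.+ n) ≡ applyUpTo f m List.++ applyUpTo (f ∘ (m ℕ.+_)) n
  applyUpTo-+ f zero    n = refl
  applyUpTo-+ f (suc m) n = cong (f 0 ∷_) (applyUpTo-+ (f ∘ suc) m n)

  length-filter-applyUpTo : ∀ {A : Set} {P : A → Set} (P? : Decidable P) (f g : ℕ → A) →
    (∀ i → P (f i) → P (g i)) → (∀ i → P (g i) → P (f i)) →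
    ∀ n → length (filter P? (applyUpTo f n)) ≡ length (filter P? (applyUpTo g n))
  length-filter-applyUpTo P? f g f⇒g g⇒f zero = refl
  length-filter-applyUpTo P? f g f⇒g g⇒f (suc n)
    with P? (f 0) | P? (g 0)
       | length-filter-applyUpTo P? (f ∘ suc) (g ∘ suc) (f⇒g ∘ suc) (g⇒f ∘ suc) n
  ... | yes _ | yes _ | eq = cong suc eq
  ... | no  _ | no  _ | eq = eq
  ... | yes p | no ¬p | _  = contradiction (f⇒g 0 p) ¬p
  ... | no ¬p | yes p | _  = contradiction (g⇒f 0 p) ¬p

  -- Residues modulo N that are not multiples of d.

  -- The representatives run over 1, ..., n, the range used by `φ`.
  nonMultiples : ℕ → ℕ → List ℕ
  nonMultiples d n = filter (λ i → ¬? (d ℕ.∣? i)) (applyUpTo suc n)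

  -- In each block of d + 1 consecutive integers, starting at 1, only the last is a multiple of d +
  -- 1.
  length-nonMultiples : ∀ d q → length (nonMultiples (suc d) (q ℕ.* suc d)) ≡ q ℕ.* d
  length-nonMultiples d zero    = refl
  length-nonMultiples d (suc q) = begin
    length (filter ∤? (applyUpTo suc (suc d ℕ.+ q ℕ.* suc d)))
      ≡⟨ cong (length ∘ filter ∤?) (applyUpTo-+ suc (suc d) (q ℕ.* suc d)) ⟩
    length (filter ∤? (applyUpTo suc (suc d) List.++ rest))
      ≡⟨ cong length (List.filter-++ ∤? (applyUpTo suc (suc d)) rest) ⟩
    length (filter ∤? (applyUpTo suc (suc d)) List.++ filter ∤? rest)
      ≡⟨ List.length-++ (filter ∤? (applyUpTo suc (suc d))) ⟩
    length (filter ∤? (applyUpTo suc (suc d))) ℕ.+ length (filter ∤? rest)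
      ≡⟨ cong₂ ℕ._+_ first-block shift ⟩
    d ℕ.+ length (nonMultiples (suc d) (q ℕ.* suc d))
      ≡⟨ cong (d ℕ.+_) (length-nonMultiples d q) ⟩
    d ℕ.+ q ℕ.* d ∎
    where
    open ≡-Reasoning
    ∤? : Decidable (λ i → ¬ (suc d ℕ.∣ i))
    ∤? i = ¬? (suc d ℕ.∣? i)
    rest : List ℕ
    rest = applyUpTo (λ i → suc (suc d ℕ.+ i)) (q ℕ.* suc d)
    shift : length (filter ∤? rest) ≡ length (nonMultiples (suc d) (q ℕ.* suc d))
    shift = length-filter-applyUpTo ∤? (λ i → suc (suc d ℕ.+ i)) suc
      (λ i ∤ ∣ → ∤ (subst (suc d ℕ.∣_) (ℕ.+-suc (suc d) i) (ℕ.∣m∣n⇒∣m+n ℕ.∣-refl ∣)))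
      (λ i ∤ ∣ → ∤ (ℕ.∣m+n∣m⇒∣n (subst (suc d ℕ.∣_) (sym (ℕ.+-suc (suc d) i)) ∣) ℕ.∣-refl))
      (q ℕ.* suc d)
    first-block : length (filter ∤? (applyUpTo suc (suc d))) ≡ d
    first-block = begin
      length (filter ∤? (applyUpTo suc (suc d)))
        ≡⟨ cong (length ∘ filter ∤?) (sym (List.applyUpTo-∷ʳ suc d)) ⟩
      length (filter ∤? (applyUpTo suc d List.∷ʳ suc d))
        ≡⟨ cong length (List.filter-++ ∤? (applyUpTo suc d) (suc d ∷ [])) ⟩
      length (filter ∤? (applyUpTo suc d) List.++ filter ∤? (suc d ∷ []))
        ≡⟨ cong₂ (λ xs ys → length (xs List.++ ys))
             (List.filter-all ∤? (ListAll.applyUpTo⁺₁ suc d (λ i<d → ℕ.>⇒∤ (s≤s i<d))))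
             (List.filter-reject ∤? (λ ∤ → ∤ ℕ.∣-refl)) ⟩
      length (applyUpTo suc d List.++ [])
        ≡⟨ cong length (List.++-identityʳ (applyUpTo suc d)) ⟩
      length (applyUpTo suc d)
        ≡⟨ List.length-applyUpTo suc d ⟩
      d ∎

  nonMultiples-unique : ∀ d n → Unique (nonMultiples d n)
  nonMultiples-unique d n = Unique.filter⁺ (λ i → ¬? (d ℕ.∣? i))
    (Unique.applyUpTo⁺₁ suc n (λ i<j _ → ℕ.<⇒≢ (s≤s i<j)))

  ∈-nonMultiples⁻ : ∀ {d n x} → x ∈ nonMultiples d n → (1 ≤ x × x ≤ n) × ¬ (d ℕ.∣ x)
  ∈-nonMultiples⁻ {d} {n} x∈ with ∈-filter⁻ (λ i → ¬? (d ℕ.∣? i)) {xs = applyUpTo suc n} x∈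
  ... | x∈′ , d∤x with _ , i<n , refl ← ∈-applyUpTo⁻ suc x∈′ = (s≤s z≤n , i<n) , d∤x

  -- As d divides N, the remainder of k is not divisible by d either. In particular it is not 0, so
  -- it lies in the range 1, ..., N.
  residue-nonMultiple : ∀ d N .{{_ : NonZero N}} k → d ℕ.∣ N → ¬ (+ d ∣ k) →
    ∃[ x ] x ∈ nonMultiples d N × k ≈ + x [mod N ]
  residue-nonMultiple d N k d∣N d∤k with k %ℕ N | n%ℕd<d k N | a≡a%ℕn+[a/ℕn]*n k N
  ... | r | r<N | k≡ = r , r∈ r r<N d∤r ,
    congruent (divides (k /ℕ N) (trans (cong (_- + r) k≡) (eq (+ r) (k /ℕ N * + N))))
    where
    eq : ∀ r q → r + q - r ≡ q
    eq = solve-∀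
    d∤r : ¬ (d ℕ.∣ r)
    d∤r d∣r = d∤k (subst (+ d ∣_) (sym k≡)
      (∣m∣n⇒∣m+n (∣ᵤ⇒∣ {+ d} {+ r} d∣r) (∣n⇒∣m*n (k /ℕ N) (∣ᵤ⇒∣ {+ d} {+ N} d∣N))))
    r∈ : ∀ r → r < N → ¬ (d ℕ.∣ r) → r ∈ nonMultiples d N
    r∈ zero    _   d∤0 = contradiction (d ℕ.∣0) d∤0
    r∈ (suc i) i<N d∤r = ∈-filter⁺ (λ i → ¬? (d ℕ.∣? i))
      (∈-applyUpTo⁺ suc (ℕ.<-trans (ℕ.n<1+n i) i<N)) d∤r

  -- The difference of two numbers in 1, ..., N has absolute value below N.
  ≈⇒≡ : ∀ {N x y} → 1 ≤ x × x ≤ N → 1 ≤ y × y ≤ N → + x ≈ + y [mod N ] → x ≡ y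
  ≈⇒≡ {N} {suc x} {suc y} (_ , x<N) (_ , y<N) (congruent p) =
    ℤ.+-injective (ℤ.i-j≡0⇒i≡j (+ suc x) (+ suc y) (trans difference
      (ℤ.∣i∣≡0⇒i≡0 (d≡0 ℤ.∣ x ℤ.⊖ y ∣ (ℤ.∣m⊝n∣≤m⊔n x y)
        (subst (λ z → N ℕ.∣ ℤ.∣ z ∣) difference (∣⇒∣ᵤ p))))))
    where
    difference : + suc x - + suc y ≡ x ℤ.⊖ y
    difference = trans (ℤ.m-n≡m⊖n (suc x) (suc y)) (ℤ.[1+m]⊖[1+n]≡m⊖n x y)
    d≡0 : ∀ d → d ≤ x ℕ.⊔ y → N ℕ.∣ d → d ≡ 0
    d≡0 zero    _  _   = refl
    d≡0 (suc d) d≤ N∣d = contradiction N∣d (ℕ.>⇒∤ (ℕ.≤-<-trans d≤ (ℕ.⊔-lub x<N y<N)))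

  -- Counting irreducible monomial minimal solutions by representatives.

  module _ (N : ℕ) .{{_ : NonTrivial N}} where

    open VecEquality (ℤ/ N)
    open Setoid (ℤ/ N) using () renaming (sym to ≈-sym)

    1≉0 : ¬ (1ℤ ≈ 0ℤ [mod N ])
    1≉0 1≈0 = ℕ.nonTrivial⇒≢1 (ℕ.∣1⇒≡1 (∣⇒∣ᵤ (≈0⇒∣ N 1≈0)))

    Indecomposableₘ : ℤ → Set
    Indecomposableₘ k = Indecomposable N k (minimalSize N k)

    irreducible⇔indecomposable : ∀ k →
      Irreducible N (monomialMinimalSolution N k) ⇔ Indecomposableₘ k
    irreducible⇔indecomposable k = mk⇔
      (irreducible⇒indecomposable N (monomialMinimalSolution N k) k (minimalSize N k)
        (minimalSize-isMinimal N k) 1≉0 ≋-refl)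
      (indecomposable⇒irreducible N k (minimalSize N k) (minimalSize-isMinimal N k))

    replicate-≋⇒≈ : ∀ {k l} s t → 1 ≤ s → replicate s k ≋ replicate t l → k ≈ l [mod N ]
    replicate-≋⇒≈ (suc s) (suc t) _ (k≈l ∷ _) = k≈l

    replicate-≈⇒≋ : ∀ {k l} s → k ≈ l [mod N ] → replicate s k ≋ replicate s l
    replicate-≈⇒≋ zero    k≈l = []
    replicate-≈⇒≋ (suc s) k≈l = k≈l ∷ replicate-≈⇒≋ s k≈l

    -- The two minimal sizes are equal only propositionally, by uniqueness, so one side is
    -- transported along that equality.
    monomialMinimalSolution-cong : ∀ {k l} → k ≈ l [mod N ] →
      monomialMinimalSolution N k ≋ monomialMinimalSolution N l
    monomialMinimalSolution-cong {k} {l} k≈l =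
      subst (λ s → monomialMinimalSolution N k ≋ replicate s l)
        (minimalSize-unique N l (minimalSize N k)
          (IsMinimalSize-resp N k≈l (minimalSize-isMinimal N k)))
        (replicate-≈⇒≋ (minimalSize N k) k≈l)

    -- The hypotheses make xs a system of representatives of the indecomposable residues. Position i
    -- goes to the monomial solution of the i-th entry; first components recover the residue, and
    -- the bounds then recover the entry.
    hasExactly : (xs : List ℕ) → Unique xs → (∀ {x} → x ∈ xs → 1 ≤ x × x ≤ N) →
      (∀ {x} → x ∈ xs → Indecomposableₘ (+ x)) →
      (∀ k → Indecomposableₘ k → ∃[ x ] x ∈ xs × k ≈ + x [mod N ]) →
      HasExactly N (length xs) (IrreducibleMonomialMinimal N)
    hasExactly xs unique bounds sound complete = record
      { to        = to
      ; cong      = λ { refl → ≋-refl }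
      ; bijective = injective , surjective
      }
      where
      to : Fin (length xs) → ∃ (IrreducibleMonomialMinimal N)
      to i = (_ , monomialMinimalSolution N x) , (x , ≋-refl)
           , Equivalence.from (irreducible⇔indecomposable x) (sound (∈-lookup i))
        where
        x : ℤ
        x = + lookup xs i
      injective : ∀ {i j} → proj₂ (proj₁ (to i)) ≋ proj₂ (proj₁ (to j)) → i ≡ j
      injective {i} {j} eq = lookup-injective unique i j
        (≈⇒≡ (bounds (∈-lookup i)) (bounds (∈-lookup j))
          (replicate-≋⇒≈ (minimalSize N (+ lookup xs i)) (minimalSize N (+ lookup xs j))
            (proj₁ (proj₁ (minimalSize-isMinimal N (+ lookup xs i)))) eq))
      preimage : ∀ {t k} {c : Vec ℤ t} → c ≋ monomialMinimalSolution N k →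
        ∃[ x ] x ∈ xs × k ≈ + x [mod N ] →
        ∃[ i ] (∀ {j} → j ≡ i → monomialMinimalSolution N (+ lookup xs j) ≋ c)
      preimage {k = k} c≋ (x , x∈xs , k≈x) = index x∈xs , λ { refl → ≋-sym (≋-trans c≋
        (monomialMinimalSolution-cong (subst (λ y → k ≈ + y [mod N ]) (lookup-index x∈xs) k≈x))) }
      surjective : ∀ ((c , _) : ∃ (IrreducibleMonomialMinimal N)) →
        ∃[ i ] (∀ {j} → j ≡ i → proj₂ (proj₁ (to j)) ≋ proj₂ c)
      surjective ((_ , c) , (k , c≋) , irr) = preimage c≋ (complete k
        (irreducible⇒indecomposable N c k (minimalSize N k) (minimalSize-isMinimal N k) 1≉0 c≋ irr))

  -- Criteria and counts for prime powers.

  indecomposable⇔∤ : ∀ {p} → Prime p → p ≢ 2 → ∀ n {k s} → IsMinimalSize (p ℕ.^ suc n) k s →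
    Indecomposable (p ℕ.^ suc n) k s ⇔ (¬ (+ p ∣ k))
  indecomposable⇔∤ p-prime p≢2 n minimal = mk⇔
    (λ (N∤k , no-sign) p∣k →
      let j , 2≤j , j≤ , sign = odd-∣⇒sign p-prime p≢2 n minimal p∣k N∤k
      in no-sign j 2≤j j≤ sign)
    (∤⇒indecomposable p-prime n minimal)

  Condition₂ : ℕ → ℤ → Set
  Condition₂ n k =
    Odd k ⊎ k ≈ + (2 ℕ.^ (n ℕ.∸ 1)) [mod 2 ℕ.^ n ] ⊎ (2 ≤ n × (∃[ a ] Odd a × k ≡ + 2 * a))

  -- For n ≥ 2, odd numbers and doubles of odd numbers together are the numbers not divisible by 4,
  -- which reduces the count to `nonMultiples 4`.
  ∤4⇒condition₂ : ∀ n {k} → 2 ≤ n → ¬ (+ 4 ∣ k) → Condition₂ n k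
  ∤4⇒condition₂ n {k} 2≤n 4∤k with + 2 ∣? k
  ... | no odd = inj₁ odd
  ... | yes (divides a k≡) = inj₂ (inj₂ (2≤n , a , odd , trans k≡ (ℤ.*-comm a (+ 2))))
    where
    odd : Odd a
    odd 2∣a = 4∤k (subst (+ 4 ∣_) (sym k≡) (*-monoˡ-∣ (+ 2) 2∣a))

  condition₂⇒∤4 : ∀ n {k} → Condition₂ n k → ¬ (+ 4 ∣ k) ⊎ k ≈ + (2 ℕ.^ (n ℕ.∸ 1)) [mod 2 ℕ.^ n ]
  condition₂⇒∤4 n (inj₁ odd) = inj₁ (odd ∘ ∣-trans (divides (+ 2) refl))
  condition₂⇒∤4 n (inj₂ (inj₁ p)) = inj₂ p
  condition₂⇒∤4 n (inj₂ (inj₂ (_ , a , odd , k≡))) =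
    inj₁ (λ 4∣k → odd (*-cancelˡ-∣ (+ 2) (subst (+ 4 ∣_) k≡ 4∣k)))

  condition₂⇒indecomposable : ∀ n {k s} → IsMinimalSize (2 ℕ.^ suc n) k s →
    Condition₂ (suc n) k → Indecomposable (2 ℕ.^ suc n) k s
  condition₂⇒indecomposable n minimal (inj₁ odd) = ∤⇒indecomposable prime[2] n minimal odd
  -- Modulo 2 the half of the modulus is 1, so k is odd.
  condition₂⇒indecomposable zero {k} minimal (inj₂ (inj₁ (congruent p))) =
    ∤⇒indecomposable prime[2] zero minimal λ 2∣k →
      p∤1 prime[2] (subst (+ 2 ∣_) (eq k) (∣m∣n⇒∣m-n 2∣k p))
    where
    eq : ∀ k → k - (k - 1ℤ) ≡ 1ℤ
    eq = solve-∀
  condition₂⇒indecomposable (suc n) minimal (inj₂ (inj₁ k≈Q)) = half⇒indecomposable n minimal k≈Q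
  condition₂⇒indecomposable zero minimal (inj₂ (inj₂ (s≤s () , _)))
  condition₂⇒indecomposable (suc n) minimal (inj₂ (inj₂ (_ , a , odd , k≡))) =
    2odd⇒indecomposable n minimal a odd k≡

  -- Write k = q 2^n; the parity of q decides.
  half-or-multiple : ∀ n {k} → + (2 ℕ.^ n) ∣ k →
    k ≈ + (2 ℕ.^ n) [mod 2 ℕ.^ suc n ] ⊎ + (2 ℕ.^ suc n) ∣ k
  half-or-multiple n {k} (divides q k≡) with + 2 ∣? q
  ... | yes 2∣q = inj₂ (subst (+ (2 ℕ.^ suc n) ∣_) (sym k≡)
          (p^∣-* prime[2] n 2∣q ∣-refl))
  ... | no odd  = inj₁ (congruent (subst (+ (2 ℕ.^ suc n) ∣_)
          (trans (eq q (+ (2 ℕ.^ n))) (cong (_- + (2 ℕ.^ n)) (sym k≡)))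
          (p^∣-* prime[2] n (odd⇒2∣pred odd) ∣-refl)))
    where
    eq : ∀ q Q → (q - 1ℤ) * Q ≡ q * Q - Q
    eq = solve-∀

  indecomposable⇒condition₂ : ∀ n {k s} → IsMinimalSize (2 ℕ.^ suc n) k s →
    Indecomposable (2 ℕ.^ suc n) k s → Condition₂ (suc n) k
  indecomposable⇒condition₂ zero    minimal (2∤k , _) = inj₁ 2∤k
  indecomposable⇒condition₂ (suc n) {k} minimal (N∤k , no-sign)
    with + 4 ∣? k | + (2 ℕ.^ suc n) ∣? k
  ... | no 4∤k  | _       = ∤4⇒condition₂ (2 ℕ.+ n) (s≤s (s≤s z≤n)) 4∤k
  ... | yes 4∣k | yes Q∣k = inj₂ (inj₁ ([ id , (λ N∣k → contradiction N∣k N∤k) ]′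
                                          (half-or-multiple (suc n) Q∣k)))
  ... | yes 4∣k | no Q∤k  = let j , 2≤j , j≤ , sign = 4∣⇒sign n minimal 4∣k Q∤k
                             in contradiction sign (no-sign j 2≤j j≤)

  -- Both sides filter the same list, and being coprime to a power of p means not being divisible by
  -- p.
  φ-primePower : ∀ {p} → Prime p → ∀ n →
    φ (p ℕ.^ suc n) ≡ length (nonMultiples p (p ℕ.^ suc n))
  φ-primePower {p} p-prime n = cong length
    (List.filter-≐ (λ i → coprime? i N) (λ i → ¬? (p ℕ.∣? i))
      ( (λ i⊥N p∣i → ℕ.nonTrivial⇒≢1 {{prime⇒nonTrivial p-prime}} (i⊥N (p∣i , ℕ.m∣m*n (p ℕ.^ n))))
      , λ p∤i → coprime-^ʳ (suc n) (prime-∤⇒coprime p-prime p∤i))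
      (applyUpTo suc N))
    where
    N : ℕ
    N = p ℕ.^ suc n

  length-nonMultiples-primePower : ∀ {p} → Prime p → ∀ n →
    length (nonMultiples p (p ℕ.^ suc n)) ≡ p ℕ.^ n ℕ.* (p ℕ.∸ 1)
  length-nonMultiples-primePower {suc d} _ n =
    trans (cong (length ∘ nonMultiples (suc d)) (ℕ.*-comm (suc d) (suc d ℕ.^ n)))
          (length-nonMultiples d (suc d ℕ.^ n))
  length-nonMultiples-primePower {zero} p-prime =
    contradiction refl (ℕ.≢-nonZero⁻¹ 0 {{prime⇒nonZero p-prime}})

  odd-count : ∀ {p} → Prime p → p ≢ 2 → ∀ n .{{_ : NonTrivial (p ℕ.^ suc n)}} →
    HasExactly (p ℕ.^ suc n) (φ (p ℕ.^ suc n)) (IrreducibleMonomialMinimal (p ℕ.^ suc n))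
  odd-count {p} p-prime p≢2 n = subst (λ m → HasExactly N m (IrreducibleMonomialMinimal N))
    (sym (φ-primePower p-prime n))
    (hasExactly N (nonMultiples p N) (nonMultiples-unique p N) (proj₁ ∘ ∈-nonMultiples⁻)
      (λ {x} x∈ → Equivalence.from (criterion (+ x)) (proj₂ (∈-nonMultiples⁻ {p} {N} x∈) ∘ ∣⇒∣ᵤ))
      (λ k ind → residue-nonMultiple p N {{ℕ.nonTrivial⇒nonZero N}} k (ℕ.m∣m*n (p ℕ.^ n))
        (Equivalence.to (criterion k) ind)))
    where
    N : ℕ
    N = p ℕ.^ suc n
    criterion : ∀ k → Indecomposableₘ N k ⇔ (¬ (+ p ∣ k))
    criterion k = indecomposable⇔∤ p-prime p≢2 n (minimalSize-isMinimal N k)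

  -- Three quarters of the N residues are not divisible by 4. The half Q of N is divisible by 4,
  -- since the exponent is at least 3, so it contributes the extra 1.
  even-count : ∀ n .{{_ : NonTrivial (2 ℕ.^ (3 ℕ.+ n))}} →
    HasExactly (2 ℕ.^ (3 ℕ.+ n)) (3 ℕ.* 2 ℕ.^ (1 ℕ.+ n) ℕ.+ 1)
      (IrreducibleMonomialMinimal (2 ℕ.^ (3 ℕ.+ n)))
  even-count n = subst (λ m → HasExactly N m (IrreducibleMonomialMinimal N)) len
    (hasExactly N (Q ∷ nonMultiples 4 N) (Q∉ ∷ nonMultiples-unique 4 N) bounds sound complete)
    where
    N Q : ℕ
    N = 2 ℕ.^ (3 ℕ.+ n)
    Q = 2 ℕ.^ (2 ℕ.+ n)
    N≡ : N ≡ 2 ℕ.^ (1 ℕ.+ n) ℕ.* 4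
    N≡ = eq (2 ℕ.^ (1 ℕ.+ n))
      where
      eq : ∀ q → 2 ℕ.* (2 ℕ.* q) ≡ q ℕ.* 4
      eq = solveℕ-∀
    4∣Q : 4 ℕ.∣ Q
    4∣Q = ℕ.divides (2 ℕ.^ n) (eq (2 ℕ.^ n))
      where
      eq : ∀ q → 2 ℕ.* (2 ℕ.* q) ≡ q ℕ.* 4
      eq = solveℕ-∀
    len : length (Q ∷ nonMultiples 4 N) ≡ 3 ℕ.* 2 ℕ.^ (1 ℕ.+ n) ℕ.+ 1
    len = trans
      (cong suc (trans (cong (length ∘ nonMultiples 4) N≡)
        (length-nonMultiples 3 (2 ℕ.^ (1 ℕ.+ n)))))
      (eq (2 ℕ.^ (1 ℕ.+ n)))
      where
      eq : ∀ q → suc (q ℕ.* 3) ≡ 3 ℕ.* q ℕ.+ 1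
      eq = solveℕ-∀
    Q∉ : ListAll.All (Q ≢_) (nonMultiples 4 N)
    Q∉ = ListAll.tabulate λ { x∈ refl → proj₂ (∈-nonMultiples⁻ {4} {N} x∈) 4∣Q }
    bounds : ∀ {x} → x ∈ Q ∷ nonMultiples 4 N → 1 ≤ x × x ≤ N
    bounds (here refl) = ℕ.m^n>0 2 (2 ℕ.+ n) , ℕ.^-monoʳ-≤ 2 (ℕ.n≤1+n (2 ℕ.+ n))
    bounds (there x∈)  = proj₁ (∈-nonMultiples⁻ x∈)
    sound : ∀ {x} → x ∈ Q ∷ nonMultiples 4 N → Indecomposableₘ N (+ x)
    sound {x} x∈ = condition₂⇒indecomposable (2 ℕ.+ n) (minimalSize-isMinimal N (+ x)) (cond x∈)
      where
      cond : x ∈ Q ∷ nonMultiples 4 N → Condition₂ (3 ℕ.+ n) (+ x)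
      cond (here refl) = inj₂ (inj₁ (≡⇒≈ N refl))
      cond (there x∈)  = ∤4⇒condition₂ (3 ℕ.+ n) (s≤s (s≤s z≤n))
        (proj₂ (∈-nonMultiples⁻ {4} {N} x∈) ∘ ∣⇒∣ᵤ)
    complete : ∀ k → Indecomposableₘ N k → ∃[ x ] x ∈ Q ∷ nonMultiples 4 N × k ≈ + x [mod N ]
    complete k ind
      with condition₂⇒∤4 (3 ℕ.+ n)
        (indecomposable⇒condition₂ (2 ℕ.+ n) (minimalSize-isMinimal N k) ind)
    ... | inj₂ k≈Q = Q , here refl , k≈Q
    ... | inj₁ 4∤k with x , x∈ , k≈x ← residue-nonMultiple 4 N {{ℕ.nonTrivial⇒nonZero N}} k
                                         (ℕ.∣-trans 4∣Q (ℕ.n∣m*n 2)) 4∤k = x , there x∈ , k≈x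

open import Data.Integer.Base as ℤ using (ℤ; +_)
open import Data.Integer.Divisibility.Signed using (_∣_)
open import Data.Nat.Base
  using (ℕ; suc; _^_; _*_; _+_; _∸_; _≤_; s≤s; NonTrivial)
open import Data.Nat.Primality using (Prime)
open import Data.Product using (_×_; _,_; ∃-syntax)
open import Data.Sum using (_⊎_)
open import Function.Bundles using (_⇔_; mk⇔)
open import Function.Construct.Composition using (_⇔-∘_)
open import Relation.Binary.PropositionalEquality using (_≡_; _≢_; refl; trans)
open import Relation.Nullary using (¬_)

open MonomialSolutions

mainTheorem1 : (p n N : ℕ) .{{_ : NonTrivial N}} → Prime p → 1 ≤ n → N ≡ p ^ n →
    (p ≢ 2 →
    ((k : ℤ) → Irreducible N (monomialMinimalSolution N k) ⇔ (¬ (+ p ∣ k)))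
    × HasExactly N (φ (p ^ n)) (IrreducibleMonomialMinimal N)
    × φ (p ^ n) ≡ p ^ (n ∸ 1) * (p ∸ 1))
    × (p ≡ 2 →
    ((k : ℤ) → Irreducible N (monomialMinimalSolution N k) ⇔
    (Odd k
    ⊎ k ≈ + (2 ^ (n ∸ 1)) [mod N ]
    ⊎ (2 ≤ n × (∃[ a ] Odd a × k ≡ + 2 ℤ.* a))))
    × (3 ≤ n →
    HasExactly N (3 * 2 ^ (n ∸ 2) + 1) (IrreducibleMonomialMinimal N)))
mainTheorem1 p (suc n) N p-prime _ refl =
    (λ p≢2 →
        (λ k → indecomposable⇔∤ p-prime p≢2 n (minimalSize-isMinimal N k) ⇔-∘
               irreducible⇔indecomposable N k)
      , odd-count p-prime p≢2 n
      , trans (φ-primePower p-prime n) (length-nonMultiples-primePower p-prime n))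
  , λ { refl →
        (λ k → mk⇔ (indecomposable⇒condition₂ n (minimalSize-isMinimal N k))
                   (condition₂⇒indecomposable n (minimalSize-isMinimal N k)) ⇔-∘
               irreducible⇔indecomposable N k)
      , λ { (s≤s (s≤s (s≤s {n = m} _))) → even-count m } }
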